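{- Let $\mathbf{V}$ be a variety of interior algebras which is a locally finite $^*$-variety. Then $t(\mathbf{V}) = t(\gamma(\mathbf{V}))$, where $\gamma(\mathbf{V}) = \{B^\circ : B\in\mathbf{V}\}$.
   Context: An interior algebra $\langle B,g\rangle$ is a Boolean algebra with an operator $g$ satisfying $g(1)=1$, $g(x\cdot y)=g(x)\cdot g(y)$, $g(x)\le x$, $g(g(x))=g(x)$; $a$ is open if $g(a)=a$. $B^\circ$ is the Heyting algebra of open elements with $a\Rightarrow b = g(-a+b)$; $\gamma(\mathbf{V})$ is a variety of Heyting algebras. $B$ is a $^*$-algebra if it is generated (as an interior algebra) by its open elements; $\mathbf{V}^*$ is the variety generated by the $^*$-algebras in $\mathbf{V}$, and $\mathbf{V}$ is a $^*$-variety if $\mathbf{V}=\mathbf{V}^*$. Unification: for a variety $\mathbf{W}$ and finitely presented $A\in\mathbf{W}$, a unifier is a pair $\langle u,B\rangle$ with $B$ finitely presented and projective in $\mathbf{W}$ and $u\colon A\to B$ a homomorphism; $A$ is unifiable if it has one. Unifiers are quasiordered by $\langle u,B\rangle\succcurlyeq\langle v,C\rangle$ iff $v=h\circ u$ for some homomorphism $h\colon B\to C$. The type of $A$ is $1$, $\omega$, $\infty$ according as this quasiordered set has a dense antichain ($\mu$-set) of cardinality $1$, finite $>1$, or infinite, and $0$ if it has none. The type $t(\mathbf{W})$ is unitary if every unifiable algebra has type $1$; finitary if all have type $1$ or $\omega$ and some has $\omega$; infinitary if all have type $1,\omega,\infty$ and some has $\infty$; nullary if some has type $0$. -}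

module Defs where

open import Algebra.Lattice.Bundles using (BooleanAlgebra)
open import Algebra.Lattice.Structures using (IsBooleanAlgebra)
import Algebra.Lattice.Properties.BooleanAlgebra as BooleanProperties
import Algebra.Lattice.Properties.Lattice as LatticeProperties
open import Data.Fin.Base using (Fin)
open import Data.Fin.Patterns using (0F; 1F)
open import Data.List.Base using (List)
open import Data.List.Membership.Propositional using (_∈_)
open import Data.Nat.Base using (ℕ; suc)
open import Data.Product.Base using (Σ; ∃; ∃-syntax; _×_; _,_; proj₁; proj₂)
open import Data.Sum.Base using (_⊎_)
open import Data.Vec.Functional using ([]; _∷_)
open import Function.Base using (_∘_)
open import Function.Bundles using (Bijection; _⇔_)
open import Function.Definitions using (Bijective; Surjective)
open import Level using (Level; 0ℓ; _⊔_) renaming (suc to lsuc)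
open import Relation.Binary.Bundles using (Setoid)
open import Relation.Binary.Core using (Rel)
open import Relation.Binary.Lattice.Structures using (IsHeytingAlgebra)
open import Relation.Binary.PropositionalEquality.Core using (_≡_)
import Relation.Binary.PropositionalEquality.Properties as ≡
import Relation.Binary.Reasoning.Setoid as SetoidReasoning
open import Relation.Nullary.Negation.Core using (¬_)
open import Relation.Unary using (Pred; _⊆_; _∩_; _≐_)

private
  variable
    ℓ : Level

Finite : Setoid 0ℓ 0ℓ → Set
Finite S = ∃[ n ] Bijection S (≡.setoid (Fin n))

------------------------------------------------------------------------
-- Universal algebra

record Signature : Set₁ where
  field
    Op    : Set
    arity : Op → ℕ

open Signature

-- Algebras are setoids with operations, so that a quotient of an algebra
-- is an algebra on the same carrier with a coarser equality.

record Algebra (S : Signature) : Set₁ where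
  field
    setoid : Setoid 0ℓ 0ℓ

  open Setoid setoid public

  field
    ⟦_⟧     : (f : Op S) → (Fin (arity S f) → Carrier) → Carrier
    ⟦⟧-cong : ∀ f {as bs} → (∀ i → as i ≈ bs i) → ⟦ f ⟧ as ≈ ⟦ f ⟧ bs

data Term (S : Signature) (X : Set) : Set where
  var : X → Term S X
  app : (f : Op S) → (Fin (arity S f) → Term S X) → Term S X

module _ {S : Signature} where

  open Algebra

  record Hom (A B : Algebra S) : Set where
    field
      to   : Carrier A → Carrier B
      cong : ∀ {x y} → _≈_ A x y → _≈_ B (to x) (to y)
      homo : ∀ f as → _≈_ B (to (⟦ A ⟧ f as)) (⟦ B ⟧ f (to ∘ as))

  open Hom

  IsSurjective : {A B : Algebra S} → Hom A B → Set
  IsSurjective {A} {B} h = Surjective (_≈_ A) (_≈_ B) (to h)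

  infix 4 _≅_

  _≅_ : Rel (Algebra S) 0ℓ
  A ≅ B = Σ (Hom A B) λ h → Bijective (_≈_ A) (_≈_ B) (to h)

  -- The subalgebra of A generated by P.

  data Generated (A : Algebra S) (P : Pred (Carrier A) 0ℓ) : Pred (Carrier A) 0ℓ where
    gen  : ∀ {x} → P x → Generated A P x
    op   : ∀ f {as} → (∀ i → Generated A P (as i)) → Generated A P (⟦ A ⟧ f as)
    resp : ∀ {x y} → _≈_ A x y → Generated A P x → Generated A P y

  GeneratedBy : (A : Algebra S) → Pred (Carrier A) 0ℓ → Set
  GeneratedBy A P = ∀ x → Generated A P x

  FinitelyGenerated : Pred (Algebra S) 0ℓ
  FinitelyGenerated A =
    ∃[ n ] Σ (Fin n → Carrier A) λ a → GeneratedBy A λ x → ∃[ i ] _≈_ A x (a i)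

  -- The congruence of A generated by a finite list of pairs.

  data Cg (A : Algebra S) (R : List (Carrier A × Carrier A)) : Rel (Carrier A) 0ℓ where
    rel     : ∀ {x y} → (x , y) ∈ R → Cg A R x y
    cg-refl : ∀ {x y} → _≈_ A x y → Cg A R x y
    cg-sym  : ∀ {x y} → Cg A R x y → Cg A R y x
    cg-trns : ∀ {x y z} → Cg A R x y → Cg A R y z → Cg A R x z
    cg-cong : ∀ f {as bs} → (∀ i → Cg A R (as i) (bs i)) → Cg A R (⟦ A ⟧ f as) (⟦ A ⟧ f bs)

  Equation : Set
  Equation = Term S ℕ × Term S ℕ

  eval : (A : Algebra S) → (ℕ → Carrier A) → Term S ℕ → Carrier A
  eval A ρ (var x)    = ρ x
  eval A ρ (app f ts) = ⟦ A ⟧ f λ i → eval A ρ (ts i)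

  infix 4 _⊨_

  _⊨_ : Algebra S → Equation → Set
  A ⊨ (s , t) = ∀ ρ → _≈_ A (eval A ρ s) (eval A ρ t)

  Mod : Pred Equation 0ℓ → Pred (Algebra S) 0ℓ
  Mod E A = ∀ e → E e → A ⊨ e

  -- Varieties are equational classes.

  IsVariety : Pred (Algebra S) ℓ → Set (lsuc 0ℓ ⊔ ℓ)
  IsVariety V = ∃[ E ] V ≐ Mod E

  VarietyGeneratedBy : Pred (Algebra S) ℓ → Pred (Algebra S) (lsuc 0ℓ ⊔ ℓ)
  VarietyGeneratedBy K A = (W : Pred (Algebra S) 0ℓ) → IsVariety W → K ⊆ W → W A

  LocallyFinite : Pred (Algebra S) ℓ → Set (lsuc 0ℓ ⊔ ℓ)
  LocallyFinite V = ∀ A → V A → FinitelyGenerated A → Finite (setoid A)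

------------------------------------------------------------------------
-- Unification in a class W of algebras

data AlgebraType : Set where
  one ω ∞ zero : AlgebraType

data UnificationType : Set where
  unitary finitary infinitary nullary : UnificationType

module _ {S : Signature} (W : Pred (Algebra S) ℓ) where

  open Algebra
  open Hom

  record IsFreeOn (n : ℕ) (F : Algebra S) (x : Fin n → Carrier F) : Set (lsuc 0ℓ ⊔ ℓ) where
    field
      inClass : W F
      extend  : ∀ B → W B → (b : Fin n → Carrier B) →
                Σ (Hom F B) λ h → ∀ i → _≈_ B (to h (x i)) (b i)
      unique  : ∀ B → W B → (h k : Hom F B) →
                (∀ i → _≈_ B (to h (x i)) (to k (x i))) →
                ∀ y → _≈_ B (to h y) (to k y)

  -- A is the quotient of a finitely generated free algebra by a finitely
  -- generated congruence.

  record IsFinitelyPresented (A : Algebra S) : Set (lsuc 0ℓ ⊔ ℓ) where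
    field
      rank       : ℕ
      free       : Algebra S
      generator  : Fin rank → Carrier free
      isFree     : IsFreeOn rank free generator
      relations  : List (Carrier free × Carrier free)
      quotient   : Hom free A
      surjective : IsSurjective quotient
      kernel     : ∀ x y → _≈_ A (to quotient x) (to quotient y) ⇔ Cg free relations x y

  IsProjective : Algebra S → Set (lsuc 0ℓ ⊔ ℓ)
  IsProjective A =
    ∀ B C → W B → W C → (f : Hom B C) → IsSurjective f → (p : Hom A C) →
    Σ (Hom A B) λ h → ∀ x → _≈_ C (to f (to h x)) (to p x)

  record Unifier (A : Algebra S) : Set (lsuc 0ℓ ⊔ ℓ) where
    field
      target              : Algebra S
      inClass             : W target
      isFinitelyPresented : IsFinitelyPresented target
      isProjective        : IsProjective target
      hom                 : Hom A target

  MoreGeneral : {A : Algebra S} → Rel (Unifier A) 0ℓ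
  MoreGeneral u v =
    Σ (Hom U.target V.target) λ h →
      ∀ x → _≈_ V.target (to V.hom x) (to h (to U.hom x))
    where
    module U = Unifier u
    module V = Unifier v

  -- A dense antichain of unifiers, given as a family indexed by I.  The
  -- members are pairwise incomparable, so its cardinality is that of I.

  record μ-Set (A : Algebra S) (I : Set) : Set (lsuc 0ℓ ⊔ ℓ) where
    field
      member    : I → Unifier A
      antichain : ∀ i j → MoreGeneral (member i) (member j) → i ≡ j
      dense     : ∀ v → ∃[ i ] MoreGeneral (member i) v

  HasAlgebraType : Algebra S → AlgebraType → Set (lsuc 0ℓ ⊔ ℓ)
  HasAlgebraType A one  = μ-Set A (Fin 1)
  HasAlgebraType A ω    = ∃[ n ] μ-Set A (Fin (suc (suc n)))
  HasAlgebraType A ∞    = Σ Set λ I → ¬ Finite (≡.setoid I) × μ-Set A I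
  HasAlgebraType A zero = ¬ Σ Set λ I → μ-Set A I

  record UnifiableAlgebra : Set (lsuc 0ℓ ⊔ ℓ) where
    field
      algebra             : Algebra S
      inClass             : W algebra
      isFinitelyPresented : IsFinitelyPresented algebra
      unifier             : Unifier algebra

  -- The graph of t: classically exactly one type holds of a given W, so
  -- t(W) = t(W′) means that W and W′ have the same types.

  HasUnificationType : UnificationType → Set (lsuc 0ℓ ⊔ ℓ)
  HasUnificationType = λ where
      unitary    → ∀ A → A ⦂ one
      finitary   → (∀ A → A ⦂ one ⊎ A ⦂ ω) × ∃[ A ] A ⦂ ω
      infinitary → (∀ A → A ⦂ one ⊎ A ⦂ ω ⊎ A ⦂ ∞) × ∃[ A ] A ⦂ ∞
      nullary    → ∃[ A ] A ⦂ zero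
    where
    infix 5 _⦂_
    _⦂_ : UnifiableAlgebra → AlgebraType → Set (lsuc 0ℓ ⊔ ℓ)
    A ⦂ t = HasAlgebraType (UnifiableAlgebra.algebra A) t

------------------------------------------------------------------------
-- Interior algebras

data InteriorOp : Set where
  ∨′ ∧′ ¬′ ⊤′ ⊥′ g′ : InteriorOp

interiorSignature : Signature
interiorSignature .Op       = InteriorOp
interiorSignature .arity ∨′ = 2
interiorSignature .arity ∧′ = 2
interiorSignature .arity ¬′ = 1
interiorSignature .arity ⊤′ = 0
interiorSignature .arity ⊥′ = 0
interiorSignature .arity g′ = 1

module InteriorOperations (B : Algebra interiorSignature) where

  open Algebra B

  infixr 7 _∧_
  infixr 6 _∨_
  infix  8 -_
  infix  4 _≤_

  _∨_ _∧_ : Carrier → Carrier → Carrier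
  x ∨ y = ⟦ ∨′ ⟧ (x ∷ y ∷ [])
  x ∧ y = ⟦ ∧′ ⟧ (x ∷ y ∷ [])

  -_ g : Carrier → Carrier
  - x = ⟦ ¬′ ⟧ (x ∷ [])
  g x = ⟦ g′ ⟧ (x ∷ [])

  ⊤ ⊥ : Carrier
  ⊤ = ⟦ ⊤′ ⟧ []
  ⊥ = ⟦ ⊥′ ⟧ []

  _≤_ : Rel Carrier 0ℓ
  x ≤ y = x ≈ x ∧ y

  Open : Pred Carrier 0ℓ
  Open a = g a ≈ a

  g-cong : ∀ {x y} → x ≈ y → g x ≈ g y
  g-cong x≈y = ⟦⟧-cong g′ λ where 0F → x≈y

record IsInteriorAlgebra (B : Algebra interiorSignature) : Set where
  open Algebra B
  open InteriorOperations B
  field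
    isBooleanAlgebra : IsBooleanAlgebra _≈_ _∨_ _∧_ -_ ⊤ ⊥
    g-⊤              : g ⊤ ≈ ⊤
    g-∧              : ∀ x y → g (x ∧ y) ≈ g x ∧ g y
    g-≤              : ∀ x → g x ≤ x
    g-idem           : ∀ x → g (g x) ≈ g x

------------------------------------------------------------------------
-- The Heyting algebra of open elements

data HeytingOp : Set where
  ∨′ ∧′ ⇒′ ⊤′ ⊥′ : HeytingOp

heytingSignature : Signature
heytingSignature .Op       = HeytingOp
heytingSignature .arity ∨′ = 2
heytingSignature .arity ∧′ = 2
heytingSignature .arity ⇒′ = 2
heytingSignature .arity ⊤′ = 0
heytingSignature .arity ⊥′ = 0

IsHeyting : Algebra heytingSignature → Set
IsHeyting H = IsHeytingAlgebra _≈_ (λ x y → x ≈ x ∧ y) _∨_ _∧_ _⇒_ (⟦ ⊤′ ⟧ []) (⟦ ⊥′ ⟧ [])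
  where
  open Algebra H
  _∨_ _∧_ _⇒_ : Carrier → Carrier → Carrier
  x ∨ y = ⟦ ∨′ ⟧ (x ∷ y ∷ [])
  x ∧ y = ⟦ ∧′ ⟧ (x ∷ y ∷ [])
  x ⇒ y = ⟦ ⇒′ ⟧ (x ∷ y ∷ [])

module OpenElements (B : Algebra interiorSignature) (isInt : IsInteriorAlgebra B) where

  open Algebra B
  open InteriorOperations B
  open IsInteriorAlgebra isInt

  private
    booleanAlgebra : BooleanAlgebra 0ℓ 0ℓ
    booleanAlgebra = record { isBooleanAlgebra = isBooleanAlgebra }

    open BooleanAlgebra booleanAlgebra
      using (lattice; ∨-cong; ∧-cong; ¬-cong; ∧-comm; ∧-distribʳ-∨; ∨-complementʳ; ∧-complementˡ)
    open BooleanProperties booleanAlgebra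
      using (∧-identityʳ; ∧-identityˡ; ∨-identityˡ; ∧-zeroˡ)

    open import Relation.Binary.Lattice.Bundles using (Lattice)
    open Lattice (LatticeProperties.∨-∧-orderTheoreticLattice lattice)
      using (antisym; ∨-least; ∧-greatest; x≤x∨y; y≤x∨y; x∧y≤x; x∧y≤y)
      renaming (trans to ≤-trans; reflexive to ≤-reflexive)

    g-mono : ∀ {x y} → x ≤ y → g x ≤ g y
    g-mono x≤y = trans (g-cong x≤y) (g-∧ _ _)

    ∨-open : ∀ {a b} → Open a → Open b → Open (a ∨ b)
    ∨-open {a} {b} oa ob = antisym (g-≤ _)
      (∨-least (≤-trans (≤-reflexive (sym oa)) (g-mono (x≤x∨y a b)))
               (≤-trans (≤-reflexive (sym ob)) (g-mono (y≤x∨y a b))))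

    ∧-open : ∀ {a b} → Open a → Open b → Open (a ∧ b)
    ∧-open oa ob = trans (g-∧ _ _) (∧-cong oa ob)

    ⊥-least : ∀ x → ⊥ ≤ x
    ⊥-least x = sym (∧-zeroˡ x)

    ⊥-open : Open ⊥
    ⊥-open = antisym (g-≤ _) (⊥-least _)

    residual₁ : ∀ {w x y} → w ∧ x ≤ y → w ≤ - x ∨ y
    residual₁ {w} {x} {y} p = ≤-trans
      (≤-reflexive (begin
        w                          ≈⟨ ∧-identityˡ w ⟨
        ⊤ ∧ w                      ≈⟨ ∧-cong (∨-complementʳ x) refl ⟨
        (x ∨ - x) ∧ w              ≈⟨ ∧-distribʳ-∨ w x (- x) ⟩
        (x ∧ w) ∨ (- x ∧ w)        ∎))
      (∨-least (≤-trans (≤-reflexive (∧-comm x w)) (≤-trans p (y≤x∨y _ _)))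
               (≤-trans (x∧y≤x _ _) (x≤x∨y _ _)))
      where open SetoidReasoning setoid

    residual₂ : ∀ {w x y} → w ≤ - x ∨ y → w ∧ x ≤ y
    residual₂ {w} {x} {y} p = ≤-trans
      (∧-greatest (≤-trans (x∧y≤x _ _) p) (x∧y≤y _ _))
      (≤-trans
        (≤-reflexive (begin
          (- x ∨ y) ∧ x            ≈⟨ ∧-distribʳ-∨ x (- x) y ⟩
          (- x ∧ x) ∨ (y ∧ x)      ≈⟨ ∨-cong (∧-complementˡ x) refl ⟩
          ⊥ ∨ (y ∧ x)              ≈⟨ ∨-identityˡ _ ⟩
          y ∧ x                    ∎))
        (x∧y≤x _ _))
      where open SetoidReasoning setoid

  openElements : Algebra heytingSignature
  openElements .Algebra.setoid = record
    { Carrier       = ∃ Open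
    ; _≈_           = λ a b → proj₁ a ≈ proj₁ b
    ; isEquivalence = record { refl = refl ; sym = sym ; trans = trans }
    }
  openElements .Algebra.⟦_⟧ ∨′ as =
    proj₁ (as 0F) ∨ proj₁ (as 1F) , ∨-open (proj₂ (as 0F)) (proj₂ (as 1F))
  openElements .Algebra.⟦_⟧ ∧′ as =
    proj₁ (as 0F) ∧ proj₁ (as 1F) , ∧-open (proj₂ (as 0F)) (proj₂ (as 1F))
  openElements .Algebra.⟦_⟧ ⇒′ as =
    g (- proj₁ (as 0F) ∨ proj₁ (as 1F)) , g-idem _
  openElements .Algebra.⟦_⟧ ⊤′ as = ⊤ , g-⊤
  openElements .Algebra.⟦_⟧ ⊥′ as = ⊥ , ⊥-open
  openElements .Algebra.⟦⟧-cong ∨′ p = ∨-cong (p 0F) (p 1F)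
  openElements .Algebra.⟦⟧-cong ∧′ p = ∧-cong (p 0F) (p 1F)
  openElements .Algebra.⟦⟧-cong ⇒′ p = g-cong (∨-cong (¬-cong (p 0F)) (p 1F))
  openElements .Algebra.⟦⟧-cong ⊤′ p = refl
  openElements .Algebra.⟦⟧-cong ⊥′ p = refl

  openElements-isHeyting : IsHeyting openElements
  openElements-isHeyting = record
    { isBoundedLattice = record
      { isLattice = record
        { isPartialOrder = record
          { isPreorder = record
            { isEquivalence = Setoid.isEquivalence (Algebra.setoid openElements)
            ; reflexive     = ≤-reflexive
            ; trans         = ≤-trans
            }
          ; antisym = antisym
          }
        ; supremum = λ _ _ → x≤x∨y _ _ , y≤x∨y _ _ , λ _ → ∨-least
        ; infimum  = λ _ _ → x∧y≤x _ _ , x∧y≤y _ _ , λ _ → ∧-greatest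
        }
      ; maximum = λ _ → sym (∧-identityʳ _)
      ; minimum = λ _ → ⊥-least _
      }
    ; exponential = λ (w , ow) _ _ →
        (λ p → ≤-trans (≤-reflexive (sym ow)) (g-mono (residual₁ p))) ,
        (λ p → residual₂ (≤-trans p (g-≤ _)))
    }

open OpenElements public using (openElements; openElements-isHeyting)

-- {B° : B ∈ V}, closed under isomorphism.

γ : Pred (Algebra interiorSignature) ℓ → Pred (Algebra heytingSignature) (lsuc 0ℓ ⊔ ℓ)
γ V H = ∃[ B ] V B × Σ (IsInteriorAlgebra B) λ isInt → H ≅ openElements B isInt

------------------------------------------------------------------------
-- *-varieties

Is*-Algebra : Pred (Algebra interiorSignature) 0ℓ
Is*-Algebra B = GeneratedBy B (InteriorOperations.Open B)

infix 10 _*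

_* : Pred (Algebra interiorSignature) ℓ → Pred (Algebra interiorSignature) (lsuc 0ℓ ⊔ ℓ)
V * = VarietyGeneratedBy (V ∩ Is*-Algebra)

Is*-Variety : Pred (Algebra interiorSignature) ℓ → Set (lsuc 0ℓ ⊔ ℓ)
Is*-Variety V = V ≐ V *

{-# OPTIONS --safe #-}
module Submission where

-- The functor B ↦ B° is an equivalence between the finitely presented algebras
-- of V and those of γ V.  An element of a *-algebra is a finite meet of elements
-- - a ∨ b with a and b open, so a Heyting homomorphism A° → B° extends uniquely
-- to A → B when A is a *-algebra.  The same normal form shows that *-algebras
-- satisfy Grzegorczyk's axiom, hence so does V = V *; and a finite algebra with
-- this axiom is a *-algebra, because each nonzero y lies above a nonzero
-- difference of open elements.  By local finiteness the finitely presented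
-- algebras are the finite ones, so all of them are *-algebras.  The equivalence
-- respects projectivity and therefore the quasiorders of unifiers.

open import Defs
open import Function.Bundles using (_⇔_)
open import Level using (Level)
open import Relation.Unary using (Pred; _⊆_)

open import Algebra.Bundles using (CommutativeSemigroup)
open import Algebra.Lattice.Bundles using (BooleanAlgebra)
import Algebra.Lattice.Properties.BooleanAlgebra as BooleanProperties
import Algebra.Lattice.Properties.Lattice as LatticeProperties
import Algebra.Properties.CommutativeSemigroup as CommutativeSemigroupProperties
open import Data.Bool.Base using (Bool; true; false)
open import Data.Fin.Base using (Fin)
open import Data.Fin.Induction using (spo-wellFounded)
open import Data.Fin.Patterns using (0F; 1F)
import Data.Fin.Properties as Fin
open import Data.List.Base using (cartesianProduct; filter; tabulate)
open import Data.List.Membership.Propositional.Properties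
  using (∈-cartesianProduct⁺; ∈-filter⁺; ∈-filter⁻; ∈-tabulate⁺)
open import Data.Nat.Base using (ℕ)
open import Data.Product.Base using (Σ; ∃; ∃-syntax; _×_; _,_; proj₁; proj₂; map₂)
open import Data.Sum.Base using () renaming (map to ⊎-map)
open import Data.Vec.Functional using ([]; _∷_)
open import Function.Base using (_∘_)
open import Function.Bundles using (Bijection; Equivalence; mk⇔)
open import Induction.WellFounded using (Acc; acc; WellFounded)
open import Function.Properties.Equivalence using () renaming (sym to ⇔-sym)
open import Level using (0ℓ; _⊔_) renaming (suc to lsuc)
open import Relation.Binary.Bundles using (Setoid)
open import Relation.Binary.Core using (Rel)
open import Relation.Binary.Definitions using (Decidable)
open import Relation.Binary.Lattice.Bundles using (Lattice)
open import Relation.Binary.PropositionalEquality.Core as ≡ using (_≡_)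
import Relation.Binary.PropositionalEquality.Properties as ≡
open import Relation.Nullary.Decidable using (Dec; yes; no; map′)
open import Relation.Nullary.Negation.Core using (¬_)

private
  variable
    ℓ ℓ′ : Level

-- Finite setoids

-- Repetitions are allowed, so a list passes to any image without deciding equality there.
Listable : Setoid 0ℓ 0ℓ → Set
Listable S = ∃[ n ] Σ (Fin n → Carrier) λ a → ∀ y → ∃[ i ] a i ≈ y
  where open Setoid S

module _ {S : Setoid 0ℓ 0ℓ} (finite : Finite S) where

  open Setoid S

  private
    module β = Bijection (proj₂ finite)

  finite-listable : Listable S
  finite-listable = proj₁ finite , proj₁ ∘ β.surjective ,
    λ y → β.to y , β.injective (proj₂ (β.surjective (β.to y)) refl)

  finite-≟ : Decidable _≈_
  finite-≟ x y = map′ β.injective β.cong (β.to x Fin.≟ β.to y)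

-- Universal algebra

module _ {S : Signature} where

  open Signature S
  open Algebra
  open Hom

  private
    variable
      A B C : Algebra S

  idʰ : Hom A A
  idʰ         .to x      = x
  idʰ         .cong p    = p
  idʰ {A = A} .homo _ _  = refl A

  infixr 9 _∘ʰ_

  _∘ʰ_ : Hom B C → Hom A B → Hom A C
  (h ∘ʰ k) .to           = to h ∘ to k
  (h ∘ʰ k) .cong         = cong h ∘ cong k
  _∘ʰ_ {C = C} h k .homo f as = trans C (cong h (homo k f as)) (homo h f (to k ∘ as))

  -- `IsSurjective` speaks about everything equal to the chosen preimage; for a homomorphism
  -- congruence supplies this from one witness.
  surjective : (h : Hom A B) → (∀ y → ∃[ x ] _≈_ B (to h x) y) → IsSurjective h
  surjective {B = B} h pre y = proj₁ (pre y) , λ z≈x → trans B (cong h z≈x) (proj₂ (pre y))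

  surjective⁻ : (h : Hom A B) → IsSurjective h → ∀ y → ∃[ x ] _≈_ B (to h x) y
  surjective⁻ {A = A} h surj y = map₂ (λ eq → eq (refl A)) (surj y)

  ≅-refl : A ≅ A
  ≅-refl {A = A} = idʰ , (λ p → p) , surjective {A} {A} idʰ λ y → y , refl A

  module _ {A B : Algebra S} (e : A ≅ B) where

    private
      h : Hom A B
      h = proj₁ e

      inj : ∀ {x y} → _≈_ B (to h x) (to h y) → _≈_ A x y
      inj = proj₁ (proj₂ e)

      preimage : ∀ y → ∃[ x ] _≈_ B (to h x) y
      preimage = surjective⁻ {A} {B} h (proj₂ (proj₂ e))

    inverse : Hom B A
    inverse .to   = proj₁ ∘ preimage
    inverse .cong {x} {y} x≈y =
      inj (trans B (proj₂ (preimage x)) (trans B x≈y (sym B (proj₂ (preimage y)))))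
    inverse .homo f as =
      inj (trans B (proj₂ (preimage _))
        (sym B (trans B (homo h f _) (⟦⟧-cong B f λ i → proj₂ (preimage (as i))))))

    to∘inverse : ∀ y → _≈_ B (to h (to inverse y)) y
    to∘inverse = proj₂ ∘ preimage

    inverse∘to : ∀ x → _≈_ A (to inverse (to h x)) x
    inverse∘to x = inj (to∘inverse (to h x))

    ≅-sym : B ≅ A
    ≅-sym = inverse
          , (λ {x} {y} p → trans B (sym B (to∘inverse x)) (trans B (cong h p) (to∘inverse y)))
          , surjective {B} {A} inverse λ x → to h x , inverse∘to x

  ≅-trans : A ≅ B → B ≅ C → A ≅ C
  ≅-trans {A = A} {B} {C} (h , inj , surj) (k , inj′ , surj′) =
    k ∘ʰ h , inj ∘ inj′ , surjective {A} {C} (k ∘ʰ h) λ z →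
      let y , ky≈z = surjective⁻ {B} {C} k surj′ z
          x , hx≈y = surjective⁻ {A} {B} h surj y
      in x , trans C (cong k hx≈y) ky≈z

  Generated-mono : {P Q : Pred (Carrier A) 0ℓ} → P ⊆ Q → Generated A P ⊆ Generated A Q
  Generated-mono {A = A} {P} {Q} P⊆Q = go
    where
    go : Generated A P ⊆ Generated A Q
    go (gen p)    = gen (P⊆Q p)
    go (op f ps)  = op f λ i → go (ps i)
    go (resp e p) = resp e (go p)

  hom-unique : {P : Pred (Carrier A) 0ℓ} → GeneratedBy A P → (h k : Hom A B) →
               (∀ {x} → P x → _≈_ B (to h x) (to k x)) → ∀ x → _≈_ B (to h x) (to k x)
  hom-unique {A = A} {B = B} {P = P} generated h k agree x = go (generated x)
    where
    go : ∀ {x} → Generated A P x → _≈_ B (to h x) (to k x)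
    go (gen p)    = agree p
    go (op f ps)  = trans B (homo h f _) (trans B (⟦⟧-cong B f λ i → go (ps i)) (sym B (homo k f _)))
    go (resp e p) = trans B (cong h (sym A e)) (trans B (go p) (cong k e))

  generated-surjective : {P : Pred (Carrier B) 0ℓ} → GeneratedBy B P → (h : Hom A B) →
                         (∀ {y} → P y → ∃[ x ] _≈_ B (to h x) y) → IsSurjective h
  generated-surjective {B = B} {A = A} {P = P} generated h onto = surjective h (go ∘ generated)
    where
    go : ∀ {y} → Generated B P y → ∃[ x ] _≈_ B (to h x) y
    go (gen p)    = onto p
    go (op f ps)  = ⟦ A ⟧ f (λ i → proj₁ (go (ps i))) ,
                    trans B (homo h f _) (⟦⟧-cong B f λ i → proj₂ (go (ps i)))
    go (resp e p) = map₂ (λ q → trans B q e) (go p)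

  listable⇒finitelyGenerated : Listable (setoid A) → FinitelyGenerated A
  listable⇒finitelyGenerated {A = A} (n , a , a-onto) =
    n , a , λ x → gen (map₂ (sym A) (a-onto x))

  hom-eval : (h : Hom A B) → ∀ ρ t → _≈_ B (to h (eval A ρ t)) (eval B (to h ∘ ρ) t)
  hom-eval {B = B} h ρ (var x)    = refl B
  hom-eval {B = B} h ρ (app f ts) = trans B (homo h f _) (⟦⟧-cong B f λ i → hom-eval h ρ (ts i))

  -- Equations may be checked after a jointly injective family of homomorphisms. One map gives
  -- subalgebras, two projections give products.
  Mod-reflect : ∀ {E} {I : Set} {B : I → Algebra S} (h : ∀ i → Hom A (B i)) →
                (∀ {x y} → (∀ i → _≈_ (B i) (to (h i) x) (to (h i) y)) → _≈_ A x y) →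
                (∀ i → Mod E (B i)) → Mod E A
  Mod-reflect {B = B} h injective models (s , t) e ρ = injective λ i →
    trans (B i) (hom-eval (h i) ρ s)
      (trans (B i) (models i (s , t) e (to (h i) ∘ ρ)) (sym (B i) (hom-eval (h i) ρ t)))

  -- Subalgebras and products

  subalgebra : (A : Algebra S) → Pred (Carrier A) 0ℓ → Algebra S
  subalgebra A P .setoid = record
    { Carrier       = ∃ (Generated A P)
    ; _≈_           = λ x y → _≈_ A (proj₁ x) (proj₁ y)
    ; isEquivalence = record { refl = refl A ; sym = sym A ; trans = trans A }
    }
  subalgebra A P .⟦_⟧ f as = ⟦ A ⟧ f (proj₁ ∘ as) , op f (proj₂ ∘ as)
  subalgebra A P .⟦⟧-cong f p = ⟦⟧-cong A f p

  inclusion : (P : Pred (Carrier A) 0ℓ) → Hom (subalgebra A P) A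
  inclusion P .to                = proj₁
  inclusion P .cong p            = p
  inclusion {A = A} P .homo _ _  = refl A

  subalgebra-generated : {P : Pred (Carrier A) 0ℓ} → GeneratedBy (subalgebra A P) (P ∘ proj₁)
  subalgebra-generated {A = A} {P = P} (x , p) = go p
    where
    go : ∀ {x} (p : Generated A P x) → Generated (subalgebra A P) (P ∘ proj₁) (x , p)
    go (gen p)    = gen p
    go (op f ps)  = op f λ i → go (ps i)
    go (resp e p) = resp e (go p)

  Mod-subalgebra : ∀ {E} {P : Pred (Carrier A) 0ℓ} → Mod E A → Mod E (subalgebra A P)
  Mod-subalgebra {A = A} {P = P} m =
    Mod-reflect {A = subalgebra A P} {I = Fin 1} (λ _ → inclusion {A} P) (λ eq → eq 0F) λ _ → m

  infixr 5 _⊗_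

  _⊗_ : Algebra S → Algebra S → Algebra S
  (A ⊗ B) .setoid = record
    { Carrier       = Carrier A × Carrier B
    ; _≈_           = λ (x , y) (x′ , y′) → _≈_ A x x′ × _≈_ B y y′
    ; isEquivalence = record
      { refl  = refl A , refl B
      ; sym   = λ (p , q) → sym A p , sym B q
      ; trans = λ (p , q) (p′ , q′) → trans A p p′ , trans B q q′
      }
    }
  (A ⊗ B) .⟦_⟧ f as    = ⟦ A ⟧ f (proj₁ ∘ as) , ⟦ B ⟧ f (proj₂ ∘ as)
  (A ⊗ B) .⟦⟧-cong f p = ⟦⟧-cong A f (proj₁ ∘ p) , ⟦⟧-cong B f (proj₂ ∘ p)

  π₁ : Hom (A ⊗ B) A
  π₁ .to               = proj₁
  π₁ .cong             = proj₁
  π₁ {A = A} .homo _ _ = refl A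

  π₂ : Hom (A ⊗ B) B
  π₂ .to               = proj₂
  π₂ .cong             = proj₂
  π₂ {B = B} .homo _ _ = refl B

  Mod-⊗ : ∀ {E} → Mod E A → Mod E B → Mod E (A ⊗ B)
  Mod-⊗ {A = A} {B = B} {E = E} mA mB = Mod-reflect {A = A ⊗ B} {B = factor} projection
    (λ eq → eq false , eq true) λ where
      false → mA
      true  → mB
    where
    factor : Bool → Algebra S
    factor false = A
    factor true  = B
    projection : ∀ i → Hom (A ⊗ B) (factor i)
    projection false = π₁ {A = A} {B = B}
    projection true  = π₂ {A = A} {B = B}

  -- Algebras presented by generators and relations

  module Presentation (E : Pred (Equation {S}) 0ℓ) (X : Set) (R : Rel (Term S X) 0ℓ) where

    substitute : (ℕ → Term S X) → Term S ℕ → Term S X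
    substitute σ (var x)    = σ x
    substitute σ (app f ts) = app f λ i → substitute σ (ts i)

    -- Equational deduction: axioms hold under every substitution, relations only for the given
    -- terms, so the elements of `X` behave as constants.
    data _∼_ : Rel (Term S X) 0ℓ where
      relation : ∀ {s t} → R s t → s ∼ t
      axiom    : ∀ {s t} → E (s , t) → ∀ σ → substitute σ s ∼ substitute σ t
      ∼-refl   : ∀ {s} → s ∼ s
      ∼-sym    : ∀ {s t} → s ∼ t → t ∼ s
      ∼-trans  : ∀ {s t u} → s ∼ t → t ∼ u → s ∼ u
      ∼-cong   : ∀ f {ss ts} → (∀ i → ss i ∼ ts i) → app f ss ∼ app f ts

    presented : Algebra S
    presented .setoid = record
      { Carrier       = Term S X
      ; _≈_           = _∼_
      ; isEquivalence = record { refl = ∼-refl ; sym = ∼-sym ; trans = ∼-trans }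
      }
    presented .⟦_⟧     = app
    presented .⟦⟧-cong = ∼-cong

    eval-presented : ∀ σ t → eval presented σ t ∼ substitute σ t
    eval-presented σ (var x)    = ∼-refl
    eval-presented σ (app f ts) = ∼-cong f λ i → eval-presented σ (ts i)

    presented∈Mod : Mod E presented
    presented∈Mod (s , t) e σ =
      ∼-trans (eval-presented σ s) (∼-trans (axiom e σ) (∼-sym (eval-presented σ t)))

    presented-generated : GeneratedBy presented λ t → ∃[ x ] t ∼ var x
    presented-generated (var x)    = gen (x , ∼-refl)
    presented-generated (app f ts) = op f λ i → presented-generated (ts i)

    interpret : (B : Algebra S) → (X → Carrier B) → Term S X → Carrier B
    interpret B b (var x)    = b x
    interpret B b (app f ts) = ⟦ B ⟧ f λ i → interpret B b (ts i)

    module _ {B : Algebra S} (B∈Mod : Mod E B) (b : X → Carrier B)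
             (sound : ∀ {s t} → R s t → _≈_ B (interpret B b s) (interpret B b t)) where

      interpret-substitute : ∀ σ t →
        _≈_ B (interpret B b (substitute σ t)) (eval B (interpret B b ∘ σ) t)
      interpret-substitute σ (var x)    = refl B
      interpret-substitute σ (app f ts) = ⟦⟧-cong B f λ i → interpret-substitute σ (ts i)

      interpret-cong : ∀ {s t} → s ∼ t → _≈_ B (interpret B b s) (interpret B b t)
      interpret-cong (relation r)    = sound r
      interpret-cong (axiom {s} {t} e σ) = trans B (interpret-substitute σ s)
        (trans B (B∈Mod (s , t) e _) (sym B (interpret-substitute σ t)))
      interpret-cong ∼-refl          = refl B
      interpret-cong (∼-sym p)       = sym B (interpret-cong p)
      interpret-cong (∼-trans p q)   = trans B (interpret-cong p) (interpret-cong q)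
      interpret-cong (∼-cong f ps)   = ⟦⟧-cong B f λ i → interpret-cong (ps i)

      lift : Hom presented B
      lift .to        = interpret B b
      lift .cong      = interpret-cong
      lift .homo _ _  = refl B

  -- Unification

  HasListableFreeAlgebras : Pred (Algebra S) ℓ → Set (lsuc 0ℓ ⊔ ℓ)
  HasListableFreeAlgebras W = ∀ n →
    Σ (Algebra S) λ F → Σ (Fin n → Carrier F) λ x → IsFreeOn W n F x × Listable (setoid F)

  module _ {W : Pred (Algebra S) ℓ} (frees : HasListableFreeAlgebras W) where

    -- The free algebra on the listed elements of `A` maps onto `A`. It is listable itself, so its
    -- kernel is generated by the finitely many listed pairs that the decidable equality of `A`
    -- identifies.
    listable⇒finitelyPresented : W A → Listable (setoid A) → Decidable (_≈_ A) →
                                 IsFinitelyPresented W A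
    listable⇒finitelyPresented {A = A} A∈W (n , a , a-onto) _≟_ = record
      { rank       = n
      ; free       = F
      ; generator  = x
      ; isFree     = isFree
      ; relations  = relations
      ; quotient   = q
      ; surjective = surjective {F} {A} q λ y →
          let i , ai≈y = a-onto y in x i , trans A (qx≈a i) ai≈y
      ; kernel     = λ s t → mk⇔ (complete s t) sound
      }
      where
      F = proj₁ (frees n)
      x = proj₁ (proj₂ (frees n))
      isFree = proj₁ (proj₂ (proj₂ (frees n)))
      e = proj₁ (proj₂ (proj₂ (proj₂ (proj₂ (frees n)))))
      e-onto = proj₂ (proj₂ (proj₂ (proj₂ (proj₂ (frees n)))))
      q : Hom F A
      q = proj₁ (IsFreeOn.extend isFree A A∈W a)
      qx≈a = proj₂ (IsFreeOn.extend isFree A A∈W a)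
      inKernel? : ∀ st → Dec (_≈_ A (to q (proj₁ st)) (to q (proj₂ st)))
      inKernel? (s , t) = to q s ≟ to q t
      pairs = cartesianProduct (tabulate e) (tabulate e)
      relations = filter inKernel? pairs
      complete : ∀ s t → _≈_ A (to q s) (to q t) → Cg F relations s t
      complete s t qs≈qt =
        let i , ei≈s = e-onto s
            j , ej≈t = e-onto t
        in cg-trns (cg-refl (sym F ei≈s)) (cg-trns
             (rel (∈-filter⁺ inKernel? (∈-cartesianProduct⁺ (∈-tabulate⁺ i) (∈-tabulate⁺ j))
               (trans A (cong q ei≈s) (trans A qs≈qt (cong q (sym F ej≈t))))))
             (cg-refl ej≈t))
      sound : ∀ {s t} → Cg F relations s t → _≈_ A (to q s) (to q t)
      sound (rel st∈)     = proj₂ (∈-filter⁻ inKernel? {xs = pairs} st∈)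
      sound (cg-refl s≈t) = cong q s≈t
      sound (cg-sym p)    = sym A (sound p)
      sound (cg-trns p r) = trans A (sound p) (sound r)
      sound (cg-cong f p) =
        trans A (homo q f _) (trans A (⟦⟧-cong A f λ i → sound (p i)) (sym A (homo q f _)))

    -- The free algebra of the presentation need not be the listed one `F′`, but freeness of both
    -- makes `h` a retraction of `F′` onto it, and its list is pushed on to `A`.
    finitelyPresented⇒listable : IsFinitelyPresented W A → Listable (setoid A)
    finitelyPresented⇒listable {A = A} presentation with frees (IsFinitelyPresented.rank presentation)
    ... | F′ , x , isFree′ , n , e , e-onto = n , to quotient ∘ to h ∘ e , λ y →
      let z , qz≈y = surjective⁻ {free} {A} quotient surj y
          i , ei≈kz = e-onto (to k z)
      in i , trans A (cong quotient (trans free (cong h ei≈kz) (h∘k≈id z))) qz≈y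
      where
      open IsFinitelyPresented presentation renaming (surjective to surj)
      module F = IsFreeOn isFree
      module F′ = IsFreeOn isFree′
      h : Hom F′ free
      h = proj₁ (F′.extend free F.inClass generator)
      k : Hom free F′
      k = proj₁ (F.extend F′ F′.inClass x)
      h∘k≈id : ∀ z → _≈_ free (to h (to k z)) z
      h∘k≈id = F.unique free F.inClass (h ∘ʰ k) idʰ λ i →
        trans free (cong h (proj₂ (F.extend F′ F′.inClass x) i))
                   (proj₂ (F′.extend free F.inClass generator) i)

-- Transfer of unification types

module _ {S S′ : Signature} {W : Pred (Algebra S) ℓ} {W′ : Pred (Algebra S′) ℓ′} where

  module _ {A : Algebra S} {A′ : Algebra S′}
           (Φ : Unifier W A → Unifier W′ A′) (Ψ : Unifier W′ A′ → Unifier W A)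
           (Φ-mono : ∀ u v → MoreGeneral W u v → MoreGeneral W′ (Φ u) (Φ v))
           (Φ-reflect : ∀ u v → MoreGeneral W′ (Φ u) (Φ v) → MoreGeneral W u v)
           (ΦΨ≽ : ∀ v → MoreGeneral W′ (Φ (Ψ v)) v)
           (≽ΦΨ : ∀ v → MoreGeneral W′ v (Φ (Ψ v)))
           where

    private
      ≽-trans : ∀ u v w → MoreGeneral W′ {A′} u v → MoreGeneral W′ v w → MoreGeneral W′ u w
      ≽-trans u v w (h , p) (k , q) =
        k ∘ʰ h , λ x → Algebra.trans (Unifier.target w) (q x) (Hom.cong k (p x))

    -- `Φ` preserves and reflects the quasiorder and meets every class of equivalent unifiers,
    -- through `Ψ`; dense antichains therefore correspond, with the same index set. Comparisons of
    -- values of `Ψ` are made after applying `Φ`.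
    μ-Set-⇔ : ∀ I → μ-Set W A I ⇔ μ-Set W′ A′ I
    μ-Set-⇔ I = mk⇔ forth back
      where
      forth : μ-Set W A I → μ-Set W′ A′ I
      forth M = record
        { member    = Φ ∘ member
        ; antichain = λ i j → antichain i j ∘ Φ-reflect (member i) (member j)
        ; dense     = λ v → let i , p = dense (Ψ v) in
            i , ≽-trans (Φ (member i)) (Φ (Ψ v)) v (Φ-mono (member i) (Ψ v) p) (ΦΨ≽ v)
        }
        where open μ-Set M
      back : μ-Set W′ A′ I → μ-Set W A I
      back M = record
        { member    = Ψ ∘ member
        ; antichain = λ i j p → antichain i j
            (≽-trans (member i) (Φ (Ψ (member i))) (member j) (≽ΦΨ (member i))
              (≽-trans (Φ (Ψ (member i))) (Φ (Ψ (member j))) (member j)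
                (Φ-mono (Ψ (member i)) (Ψ (member j)) p) (ΦΨ≽ (member j))))
        ; dense     = λ v → let i , p = dense (Φ v) in
            i , Φ-reflect (Ψ (member i)) v
              (≽-trans (Φ (Ψ (member i))) (member i) (Φ v) (ΦΨ≽ (member i)) p)
        }
        where open μ-Set M

  -- An equivalence for every `I` is asked because `zero` denies μ-sets over all index sets, which
  -- reverses the direction.
  algebraType-map : ∀ {A A′} → (∀ I → μ-Set W A I ⇔ μ-Set W′ A′ I) →
                    ∀ t → HasAlgebraType W A t → HasAlgebraType W′ A′ t
  algebraType-map eq one  M              = Equivalence.to (eq _) M
  algebraType-map eq ω    (n , M)        = n , Equivalence.to (eq _) M
  algebraType-map eq ∞    (I , inf , M)  = I , inf , Equivalence.to (eq _) M
  algebraType-map eq zero none (I , M)   = none (I , Equivalence.from (eq _) M)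

MatchesUnifiableAlgebras : ∀ {S S′} → Pred (Algebra S) ℓ → Pred (Algebra S′) ℓ′ →
                          Set (lsuc 0ℓ ⊔ ℓ ⊔ ℓ′)
MatchesUnifiableAlgebras W W′ = ∀ (A : UnifiableAlgebra W) → Σ (UnifiableAlgebra W′) λ A′ →
  ∀ I → μ-Set W (UnifiableAlgebra.algebra A) I ⇔ μ-Set W′ (UnifiableAlgebra.algebra A′) I

module _ {S S′ : Signature} {W : Pred (Algebra S) ℓ} {W′ : Pred (Algebra S′) ℓ′}
         (forth : MatchesUnifiableAlgebras W W′) (back : MatchesUnifiableAlgebras W′ W) where

  private
    push : ∀ t → ∃[ A ] HasAlgebraType W (UnifiableAlgebra.algebra A) t →
           ∃[ A ] HasAlgebraType W′ (UnifiableAlgebra.algebra A) t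
    push t (A , p) = proj₁ (forth A) , algebraType-map (proj₂ (forth A)) t p

    pull : ∀ (A : UnifiableAlgebra W′) t →
           HasAlgebraType W (UnifiableAlgebra.algebra (proj₁ (back A))) t →
           HasAlgebraType W′ (UnifiableAlgebra.algebra A) t
    pull A t = algebraType-map (λ I → ⇔-sym (proj₂ (back A) I)) t

  -- The clauses on all algebras of `W′` are pulled along `back`, the existential ones pushed along
  -- `forth`.
  unificationType-map : ∀ τ → HasUnificationType W τ → HasUnificationType W′ τ
  unificationType-map unitary    all       = λ A → pull A one (all (proj₁ (back A)))
  unificationType-map finitary   (all , e) =
    (λ A → ⊎-map (pull A one) (pull A ω) (all (proj₁ (back A)))) , push ω e
  unificationType-map infinitary (all , e) =
    (λ A → ⊎-map (pull A one) (⊎-map (pull A ω) (pull A ∞)) (all (proj₁ (back A)))) , push ∞ e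
  unificationType-map nullary    e         = push zero e

-- Interior algebras

module _ {A B : Algebra interiorSignature} (h : Hom A B) where

  private
    module A = InteriorOperations A
    module B = InteriorOperations B
  open Algebra B
  open Hom h

  hom-∨ : ∀ x y → to (x A.∨ y) ≈ to x B.∨ to y
  hom-∨ x y = trans (homo ∨′ _) (⟦⟧-cong ∨′ λ { 0F → refl ; 1F → refl })

  hom-∧ : ∀ x y → to (x A.∧ y) ≈ to x B.∧ to y
  hom-∧ x y = trans (homo ∧′ _) (⟦⟧-cong ∧′ λ { 0F → refl ; 1F → refl })

  hom-- : ∀ x → to (A.- x) ≈ B.- to x
  hom-- x = trans (homo ¬′ _) (⟦⟧-cong ¬′ λ { 0F → refl })

  hom-g : ∀ x → to (A.g x) ≈ B.g (to x)
  hom-g x = trans (homo g′ _) (⟦⟧-cong g′ λ { 0F → refl })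

  hom-⊤ : to A.⊤ ≈ B.⊤
  hom-⊤ = trans (homo ⊤′ _) (⟦⟧-cong ⊤′ λ ())

  hom-⊥ : to A.⊥ ≈ B.⊥
  hom-⊥ = trans (homo ⊥′ _) (⟦⟧-cong ⊥′ λ ())

  hom-open : ∀ {x} → A.Open x → B.Open (to x)
  hom-open {x} ox = trans (sym (hom-g x)) (cong ox)

module InteriorProperties {B : Algebra interiorSignature} (isInt : IsInteriorAlgebra B) where

  open Algebra B
  open InteriorOperations B
  open IsInteriorAlgebra isInt

  booleanAlgebra : BooleanAlgebra 0ℓ 0ℓ
  booleanAlgebra = record { isBooleanAlgebra = isBooleanAlgebra }

  open BooleanAlgebra booleanAlgebra public
    using ( lattice; ∨-cong; ∧-cong; ¬-cong; ∨-comm; ∧-assoc; ∨-distribˡ-∧; ∨-distribʳ-∧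
          ; ∧-distribˡ-∨; ∨-complementʳ; ∧-complementʳ)
  open BooleanProperties booleanAlgebra public
    using ( ∧-identityʳ; ∧-identityˡ; ∨-identityˡ; ∨-identityʳ; ∨-zeroˡ; ∨-zeroʳ; ∧-zeroˡ
          ; deMorgan₁; deMorgan₂; ¬-involutive; ¬⊤≈⊥; ∨-isSemigroup)
  open Lattice (LatticeProperties.∨-∧-orderTheoreticLattice lattice) public
    using (antisym; ∨-least; ∧-greatest; x≤x∨y; y≤x∨y; x∧y≤x; x∧y≤y)
    renaming (trans to ≤-trans; reflexive to ≤-reflexive)

  private
    ∨-commutativeSemigroup : CommutativeSemigroup 0ℓ 0ℓ
    ∨-commutativeSemigroup = record
      { isCommutativeSemigroup = record { isSemigroup = ∨-isSemigroup ; comm = ∨-comm } }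

    open CommutativeSemigroupProperties ∨-commutativeSemigroup using (interchange)

  ≤-refl : ∀ {x} → x ≤ x
  ≤-refl = ≤-reflexive refl

  ≤⊤ : ∀ {x} → x ≤ ⊤
  ≤⊤ = sym (∧-identityʳ _)

  ⊥≤ : ∀ {x} → ⊥ ≤ x
  ⊥≤ = sym (∧-zeroˡ _)

  ∧-monoˡ : ∀ {x y z} → x ≤ y → x ∧ z ≤ y ∧ z
  ∧-monoˡ x≤y = ∧-greatest (≤-trans (x∧y≤x _ _) x≤y) (x∧y≤y _ _)

  residual : ∀ {w x y} → w ∧ x ≤ y → w ≤ - x ∨ y
  residual {w} {x} {y} p = ≤-trans
    (≤-reflexive (trans (sym (∧-identityʳ w))
      (trans (∧-cong refl (sym (∨-complementʳ x))) (∧-distribˡ-∨ w x (- x)))))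
    (∨-least (≤-trans p (y≤x∨y _ _)) (≤-trans (x∧y≤y _ _) (x≤x∨y _ _)))

  modus-ponens : ∀ {w x y} → w ≤ - x ∨ y → w ≤ x → w ≤ y
  modus-ponens {w} {x} {y} p q = ≤-trans (∧-greatest q p)
    (≤-trans (≤-reflexive (∧-distribˡ-∨ x (- x) y))
      (∨-least (≤-trans (≤-reflexive (∧-complementʳ x)) ⊥≤) (x∧y≤y _ _)))

  ≤⇒⊤ : ∀ {x y} → x ≤ y → - x ∨ y ≈ ⊤
  ≤⇒⊤ x≤y = antisym ≤⊤ (residual (≤-trans (x∧y≤y _ _) x≤y))

  ⊤⇒≤ : ∀ {x y} → - x ∨ y ≈ ⊤ → x ≤ y
  ⊤⇒≤ p = modus-ponens (≤-trans ≤⊤ (≤-reflexive (sym p))) ≤-refl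

  ∧≈⊤ : ∀ {x y} → x ∧ y ≈ ⊤ → x ≈ ⊤ × y ≈ ⊤
  ∧≈⊤ p = antisym ≤⊤ (≤-trans (≤-reflexive (sym p)) (x∧y≤x _ _))
        , antisym ≤⊤ (≤-trans (≤-reflexive (sym p)) (x∧y≤y _ _))

  g-mono : ∀ {x y} → x ≤ y → g x ≤ g y
  g-mono x≤y = trans (g-cong x≤y) (g-∧ _ _)

  open-≤ : ∀ {u x} → Open u → u ≤ x → u ≤ g x
  open-≤ ou u≤x = ≤-trans (≤-reflexive (sym ou)) (g-mono u≤x)

  ∧-open : ∀ {u v} → Open u → Open v → Open (u ∧ v)
  ∧-open ou ov = trans (g-∧ _ _) (∧-cong ou ov)

  ∨-open : ∀ {u v} → Open u → Open v → Open (u ∨ v)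
  ∨-open ou ov = antisym (g-≤ _) (∨-least (open-≤ ou (x≤x∨y _ _)) (open-≤ ov (y≤x∨y _ _)))

  ⊥-open : Open ⊥
  ⊥-open = antisym (g-≤ _) ⊥≤

  -- Conjunctive normal forms

  record HeytingClosed (Γ : Pred Carrier 0ℓ) : Set where
    field
      ∨-closed : ∀ {a b} → Γ a → Γ b → Γ (a ∨ b)
      ∧-closed : ∀ {a b} → Γ a → Γ b → Γ (a ∧ b)
      ⇒-closed : ∀ {a b} → Γ a → Γ b → Γ (g (- a ∨ b))
      ⊤-closed : Γ ⊤
      ⊥-closed : Γ ⊥

  Open-closed : HeytingClosed Open
  Open-closed = record
    { ∨-closed = ∨-open
    ; ∧-closed = ∧-open
    ; ⇒-closed = λ _ _ → g-idem _
    ; ⊤-closed = g-⊤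
    ; ⊥-closed = ⊥-open
    }

  -- A finite meet of clauses `- a ∨ b`. The set `Γ` is a parameter because two instances occur: the
  -- open elements, and the graph of a Heyting homomorphism inside a product.
  data NormalForm (Γ : Pred Carrier 0ℓ) (x : Carrier) : Set where
    top  : x ≈ ⊤ → NormalForm Γ x
    meet : ∀ {a b y} → Γ a → Γ b → NormalForm Γ y → x ≈ (- a ∨ b) ∧ y → NormalForm Γ x

  module _ {Γ : Pred Carrier 0ℓ} (closed : HeytingClosed Γ) where

    open HeytingClosed closed

    private
      NF : Pred Carrier 0ℓ
      NF = NormalForm Γ

    nf-resp : ∀ {x y} → x ≈ y → NF x → NF y
    nf-resp e (top p)          = top (trans (sym e) p)
    nf-resp e (meet γa γb n p) = meet γa γb n (trans (sym e) p)

    nf-∧ : ∀ {x y} → NF x → NF y → NF (x ∧ y)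
    nf-∧ (top p)          m = nf-resp (sym (trans (∧-cong p refl) (∧-identityˡ _))) m
    nf-∧ (meet γa γb n p) m = meet γa γb (nf-∧ n m) (trans (∧-cong p refl) (∧-assoc _ _ _))

    nf-clause : ∀ {a b} → Γ a → Γ b → NF (- a ∨ b)
    nf-clause γa γb = meet γa γb (top refl) (sym (∧-identityʳ _))

    -- A join of two clauses is again one clause: `(- a ∨ b) ∨ (- c ∨ d)` equals
    -- `- (a ∧ c) ∨ (b ∨ d)`.
    nf-clause-∨ : ∀ {a b y} → Γ a → Γ b → NF y → NF ((- a ∨ b) ∨ y)
    nf-clause-∨ γa γb (top p)          = top (trans (∨-cong refl p) (∨-zeroʳ _))
    nf-clause-∨ γa γb (meet γc γd m p) =
      meet (∧-closed γa γc) (∨-closed γb γd) (nf-clause-∨ γa γb m)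
        (trans (∨-cong refl p) (trans (∨-distribˡ-∧ _ _ _)
          (∧-cong (trans (interchange _ _ _ _) (∨-cong (sym (deMorgan₁ _ _)) refl)) refl)))

    nf-∨ : ∀ {x y} → NF x → NF y → NF (x ∨ y)
    nf-∨ (top p)          m = top (trans (∨-cong p refl) (∨-zeroˡ _))
    nf-∨ (meet γa γb n p) m = nf-resp (sym (trans (∨-cong p refl) (∨-distribʳ-∧ _ _ _)))
      (nf-∧ (nf-clause-∨ γa γb m) (nf-∨ n m))

    nf-Γ : ∀ {a} → Γ a → NF a
    nf-Γ γa = nf-resp (trans (∨-cong ¬⊤≈⊥ refl) (∨-identityˡ _)) (nf-clause ⊤-closed γa)

    nf--Γ : ∀ {a} → Γ a → NF (- a)
    nf--Γ γa = nf-resp (∨-identityʳ _) (nf-clause γa ⊥-closed)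

    nf-- : ∀ {x} → NF x → NF (- x)
    nf-- (top p)          = nf-resp (sym (trans (¬-cong p) ¬⊤≈⊥)) (nf-Γ ⊥-closed)
    nf-- (meet γa γb n p) = nf-resp
      (sym (trans (¬-cong p) (trans (deMorgan₁ _ _)
        (∨-cong (trans (deMorgan₂ _ _) (∧-cong (¬-involutive _) refl)) refl))))
      (nf-∨ (nf-∧ (nf-Γ γa) (nf--Γ γb)) (nf-- n))

    -- `g` distributes over the meet and turns each clause into a Heyting implication, so it leads
    -- from normal forms back into `Γ`. This is why normal forms are closed under `g`.
    g-nf : ∀ {x} → NF x → ∃[ c ] Γ c × g x ≈ c
    g-nf (top p)          = ⊤ , ⊤-closed , trans (g-cong p) g-⊤
    g-nf (meet γa γb n p) = let c , γc , e = g-nf n in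
      _ , ∧-closed (⇒-closed γa γb) γc , trans (g-cong p) (trans (g-∧ _ _) (∧-cong refl e))

    generated⇒nf : ∀ {x} → Generated B Γ x → NF x
    generated⇒nf (gen γx)   = nf-Γ γx
    generated⇒nf (op ∨′ ps) = nf-resp (⟦⟧-cong ∨′ λ { 0F → refl ; 1F → refl })
      (nf-∨ (generated⇒nf (ps 0F)) (generated⇒nf (ps 1F)))
    generated⇒nf (op ∧′ ps) = nf-resp (⟦⟧-cong ∧′ λ { 0F → refl ; 1F → refl })
      (nf-∧ (generated⇒nf (ps 0F)) (generated⇒nf (ps 1F)))
    generated⇒nf (op ¬′ ps) = nf-resp (⟦⟧-cong ¬′ λ { 0F → refl }) (nf-- (generated⇒nf (ps 0F)))
    generated⇒nf (op ⊤′ ps) = nf-resp (⟦⟧-cong ⊤′ λ ()) (nf-Γ ⊤-closed)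
    generated⇒nf (op ⊥′ ps) = nf-resp (⟦⟧-cong ⊥′ λ ()) (nf-Γ ⊥-closed)
    generated⇒nf (op g′ ps) = let c , γc , e = g-nf (generated⇒nf (ps 0F)) in
      nf-resp (trans (sym e) (⟦⟧-cong g′ λ { 0F → refl })) (nf-Γ γc)
    generated⇒nf (resp e p) = nf-resp e (generated⇒nf p)

  -- Grzegorczyk's axiom

  grz : Carrier → Carrier
  grz x = g (- x ∨ g x)

  -- The element n agrees with x on u.  Passing from u to u ∧ b makes the clause
  -- - a ∨ b of n redundant, so the induction is on n rather than on x itself.
  -- Grzegorczyk's axiom is the case u = g (- grz x ∨ x), n = x.

  grz-rule : ∀ {u x n} → NormalForm Open n → Open u → u ∧ x ≤ n → u ∧ n ≤ x →
             u ∧ grz x ≤ x → u ≤ x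
  grz-rule (top n≈⊤) ou _ n≤x _ =
    ≤-trans (∧-greatest ≤-refl (≤-trans ≤⊤ (≤-reflexive (sym n≈⊤)))) n≤x
  grz-rule {u} {x} {n} (meet {a} {b} {m} oa ob nf n≈) ou x≤n n≤x hyp =
    grz-rule nf ou (≤-trans x≤n n≤m)
      (≤-trans (∧-greatest (x∧y≤x _ _)
        (≤-trans (∧-monoˡ u≤clause) (≤-reflexive (sym n≈)))) n≤x)
      hyp
    where
    n≤clause : n ≤ - a ∨ b
    n≤clause = ≤-trans (≤-reflexive n≈) (x∧y≤x _ _)
    n≤m : n ≤ m
    n≤m = ≤-trans (≤-reflexive n≈) (x∧y≤y _ _)
    u∧b≤x : u ∧ b ≤ x
    u∧b≤x = grz-rule nf (∧-open ou ob)
      (≤-trans (∧-monoˡ (x∧y≤x _ _)) (≤-trans x≤n n≤m))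
      (≤-trans (∧-greatest (≤-trans (x∧y≤x _ _) (x∧y≤x _ _))
        (≤-trans (∧-monoˡ (≤-trans (x∧y≤y _ _) (y≤x∨y _ _))) (≤-reflexive (sym n≈)))) n≤x)
      (≤-trans (∧-monoˡ (x∧y≤x _ _)) hyp)
    u∧a∧x≤u∧b : (u ∧ a) ∧ x ≤ u ∧ b
    u∧a∧x≤u∧b = ∧-greatest (≤-trans (x∧y≤x _ _) (x∧y≤x _ _))
      (modus-ponens (≤-trans (∧-monoˡ (x∧y≤x _ _)) (≤-trans x≤n n≤clause))
                    (≤-trans (x∧y≤x _ _) (x∧y≤y _ _)))
    -- Within `u ∧ a`, `x` implies `u ∧ b`, which is open and below `x`, hence below `g x`. So the
    -- open element `u ∧ a` lies below `grz x` and `hyp` applies. Then `u ∧ a` is also below `b`,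
    -- and the clause holds on all of `u`.
    u∧a≤x : u ∧ a ≤ x
    u∧a≤x = ≤-trans
      (∧-greatest (x∧y≤x _ _)
        (open-≤ (∧-open ou oa)
          (residual (≤-trans u∧a∧x≤u∧b (open-≤ (∧-open ou ob) u∧b≤x)))))
      hyp
    u≤clause : u ≤ - a ∨ b
    u≤clause = residual (≤-trans (∧-greatest ≤-refl u∧a≤x)
      (≤-trans u∧a∧x≤u∧b (x∧y≤y _ _)))

  -- In modal notation `□(□(x → □x) → x) → x`, where `grz x` is `□(x → □x)`.
  Grzegorczyk : Set
  Grzegorczyk = ∀ x → g (- grz x ∨ x) ≤ x

  *-algebra⇒grzegorczyk : Is*-Algebra B → Grzegorczyk
  *-algebra⇒grzegorczyk generated x =
    grz-rule (generated⇒nf Open-closed (generated x)) (g-idem _) (x∧y≤y _ _) (x∧y≤y _ _)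
      (modus-ponens (≤-trans (x∧y≤x _ _) (g-≤ _)) (x∧y≤y _ _))

  private
    generated-∨ : ∀ {P x y} → Generated B P x → Generated B P y → Generated B P (x ∨ y)
    generated-∨ p q = op ∨′ λ { 0F → p ; 1F → q }

    generated-∧ : ∀ {P x y} → Generated B P x → Generated B P y → Generated B P (x ∧ y)
    generated-∧ p q = op ∧′ λ { 0F → p ; 1F → q }

    generated-- : ∀ {P x} → Generated B P x → Generated B P (- x)
    generated-- p = op ¬′ λ { 0F → p }

  -- Every nonzero y lies above the nonzero difference grz (- y) ∧ y of two open elements.

  module _ (grzegorczyk : Grzegorczyk) where

    -- Below `grz (- y)` the elements `- y` and `g (- y)` coincide, so `y` agrees there with the
    -- complement of an open element.
    grz-∧-generated : ∀ y → Generated B Open (grz (- y) ∧ y)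
    grz-∧-generated y = resp
      (antisym
        (∧-greatest (x∧y≤x _ _)
          (≤-trans (residual (≤-trans
              (∧-greatest below (≤-trans (x∧y≤x _ _) (x∧y≤y _ _))) (≤-reflexive (∧-complementʳ _))))
            (∨-least (≤-reflexive (¬-involutive y)) ⊥≤)))
        (∧-greatest (x∧y≤x _ _)
          (≤-trans (residual (≤-trans (∧-greatest
              (≤-trans (x∧y≤x _ _) (x∧y≤y _ _))
              (≤-trans (x∧y≤y _ _) (g-≤ _))) (≤-reflexive (∧-complementʳ y))))
            (≤-reflexive (∨-identityʳ _)))))
      (generated-∧ (gen (g-idem _)) (generated-- (gen (g-idem _))))
      where
      below : ((grz (- y) ∧ - g (- y)) ∧ - y) ≤ g (- y)
      below = modus-ponens (≤-trans (x∧y≤x _ _) (≤-trans (x∧y≤x _ _) (g-≤ _))) (x∧y≤y _ _)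

    -- If `grz (- y)` is disjoint from `y`, it lies below `- y`; the left side of the axiom at `- y`
    -- is then `g ⊤`, which forces `- y` to be `⊤`.
    grz-∧≈⊥ : ∀ {y} → grz (- y) ∧ y ≈ ⊥ → y ≈ ⊥
    grz-∧≈⊥ {y} p = trans (sym (¬-involutive y)) (trans (¬-cong -y≈⊤) ¬⊤≈⊥)
      where
      grz≤-y : grz (- y) ≤ - y
      grz≤-y = ≤-trans (residual (≤-reflexive p)) (≤-reflexive (∨-identityʳ _))
      -y≈⊤ : - y ≈ ⊤
      -y≈⊤ = antisym ≤⊤ (≤-trans
        (≤-reflexive (sym (trans (g-cong (≤⇒⊤ grz≤-y)) g-⊤))) (grzegorczyk (- y)))

    -- Well-founded induction along the strict order, carried by the indices of the list: the
    -- generated part `grz (- y) ∧ y` is split off from a nonzero `y`, and a strictly smaller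
    -- element remains.
    grzegorczyk⇒*-algebra : Listable setoid → Decidable _≈_ → Is*-Algebra B
    grzegorczyk⇒*-algebra (n , e , e-onto) _≟_ y =
      let i , ei≈y = e-onto y in go (⊏-wellFounded i) ei≈y
      where
      _⊏_ : Rel (Fin n) 0ℓ
      i ⊏ j = e i ≤ e j × ¬ e i ≈ e j

      ⊏-wellFounded : WellFounded _⊏_
      ⊏-wellFounded = spo-wellFounded {_≈_ = _≡_} record
        { isEquivalence = ≡.isEquivalence
        ; irrefl        = λ { ≡.refl (_ , i≉i) → i≉i refl }
        ; trans         = λ (i≤j , i≉j) (j≤k , j≉k) → ≤-trans i≤j j≤k ,
            λ i≈k → j≉k (antisym j≤k (≤-trans (≤-reflexive (sym i≈k)) i≤j))
        ; <-resp-≈      = (λ { ≡.refl p → p }) , λ { ≡.refl p → p }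
        }

      go : ∀ {i y} → Acc _⊏_ i → e i ≈ y → Generated B Open y
      go {i} {y} (acc smaller) ei≈y with y ≟ ⊥
      ... | yes y≈⊥ = resp (sym y≈⊥) (gen ⊥-open)
      ... | no  y≉⊥ = resp
        (antisym (∨-least (x∧y≤y _ _) (x∧y≤x _ _))
          (≤-trans (∧-greatest ≤-refl (≤-trans ≤⊤ (≤-reflexive (sym (∨-complementʳ z)))))
            (≤-trans (≤-reflexive (∧-distribˡ-∨ y z (- z)))
              (∨-least (≤-trans (x∧y≤y _ _) (x≤x∨y _ _)) (y≤x∨y _ _)))))
        (generated-∨ (grz-∧-generated y) (go (smaller rest⊏y) (proj₂ (e-onto rest))))
        where
        z rest : Carrier
        z    = grz (- y) ∧ y
        rest = y ∧ - z
        ej≈rest = proj₂ (e-onto rest)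
        rest⊏y : proj₁ (e-onto rest) ⊏ i
        rest⊏y = ≤-trans (≤-reflexive ej≈rest) (≤-trans (x∧y≤x _ _) (≤-reflexive (sym ei≈y)))
          -- If `rest` were equal to `y`, then `z`, which is below `y`, would be below `- z` and
          -- hence `⊥`, so that `y` would be `⊥` too.
          , λ ej≈ei → y≉⊥ (grz-∧≈⊥ (antisym
              (≤-trans (∧-greatest ≤-refl
                (≤-trans (x∧y≤y _ _) (≤-trans
                  (≤-reflexive (trans (sym ei≈y) (trans (sym ej≈ei) ej≈rest))) (x∧y≤y _ _))))
                (≤-reflexive (∧-complementʳ z)))
              ⊥≤))

-- Grzegorczyk's axiom as an equation

private
  g-term : Term interiorSignature ℕ → Term interiorSignature ℕ
  g-term t = app g′ (t ∷ [])

  ⊃-term : Term interiorSignature ℕ → Term interiorSignature ℕ → Term interiorSignature ℕ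
  ⊃-term s t = app ∨′ (app ¬′ (s ∷ []) ∷ t ∷ [])

  grz-term : Term interiorSignature ℕ
  grz-term = g-term (⊃-term (g-term (⊃-term (var 0) (g-term (var 0)))) (var 0))

-- Since `x ≤ y` is `x ≈ x ∧ y`, the axiom is an equation; it thus defines a variety and can pass
-- from generating algebras to `V *`.
grzegorczykEquation : Equation
grzegorczykEquation = grz-term , app ∧′ (grz-term ∷ var 0 ∷ [])

module _ {B : Algebra interiorSignature} (isInt : IsInteriorAlgebra B) where

  open Algebra B
  open InteriorOperations B
  open InteriorProperties isInt

  private
    eval-g : ∀ {ρ t x} → eval B ρ t ≈ x → eval B ρ (g-term t) ≈ g x
    eval-g p = ⟦⟧-cong g′ λ { 0F → p }

    eval-⊃ : ∀ {ρ s t x y} → eval B ρ s ≈ x → eval B ρ t ≈ y → eval B ρ (⊃-term s t) ≈ - x ∨ y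
    eval-⊃ p q = ⟦⟧-cong ∨′ λ { 0F → ⟦⟧-cong ¬′ (λ { 0F → p }) ; 1F → q }

    eval-grz : ∀ ρ → eval B ρ grz-term ≈ g (- grz (ρ 0) ∨ ρ 0)
    eval-grz ρ = eval-g {ρ} (eval-⊃ {ρ}
      (eval-g {ρ} (eval-⊃ {ρ} {var 0} refl (eval-g {ρ} {var 0} refl))) refl)

  ⊨⇒grzegorczyk : B ⊨ grzegorczykEquation → Grzegorczyk
  ⊨⇒grzegorczyk eq x = trans (sym (eval-grz ρ))
    (trans (eq ρ) (⟦⟧-cong ∧′ λ { 0F → eval-grz ρ ; 1F → refl }))
    where
    ρ : ℕ → Carrier
    ρ _ = x

  grzegorczyk⇒⊨ : Grzegorczyk → B ⊨ grzegorczykEquation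
  grzegorczyk⇒⊨ grzegorczyk ρ = trans (eval-grz ρ) (trans (grzegorczyk (ρ 0))
    (⟦⟧-cong ∧′ λ { 0F → sym (eval-grz ρ) ; 1F → refl }))

-- Homomorphisms and open elements

module _ {A B : Algebra interiorSignature} (iA : IsInteriorAlgebra A) (iB : IsInteriorAlgebra B) where

  open Algebra
  open Hom

  restrict : Hom A B → Hom (openElements A iA) (openElements B iB)
  restrict h .to (x , ox)  = to h x , hom-open h ox
  restrict h .cong         = cong h
  restrict h .homo ∨′ _    = hom-∨ h _ _
  restrict h .homo ∧′ _    = hom-∧ h _ _
  restrict h .homo ⇒′ _    = trans B (hom-g h _)
    (InteriorOperations.g-cong B (trans B (hom-∨ h _ _) (∨-cong (hom-- h _) (refl B))))
    where open InteriorProperties iB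
  restrict h .homo ⊤′ _    = hom-⊤ h
  restrict h .homo ⊥′ _    = hom-⊥ h

  -- A preimage of an open element need not be open, but its interior is, and has the same image.
  restrict-surjective : (h : Hom A B) → IsSurjective h → IsSurjective (restrict h)
  restrict-surjective h surj = surjective (restrict h) λ (y , oy) →
    let x , hx≈y = surjective⁻ h surj y
    in (InteriorOperations.g A x , IsInteriorAlgebra.g-idem iA x) ,
       trans B (hom-g h x) (trans B (InteriorOperations.g-cong B hx≈y) oy)

  -- The graph of f generates a subalgebra of A ⊗ B which, by normal forms, is
  -- the graph of a function.

  module Extension (iA⊗B : IsInteriorAlgebra (A ⊗ B)) (A* : Is*-Algebra A)
                   (f : Hom (openElements A iA) (openElements B iB)) where

    private
      module A° = Algebra (openElements A iA)
      module IA = InteriorOperations A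
      module IB = InteriorOperations B
      module PA = InteriorProperties iA
      module PB = InteriorProperties iB
      module P = InteriorProperties iA⊗B
      module IP = InteriorOperations (A ⊗ B)

      Graph : Pred (Carrier (A ⊗ B)) 0ℓ
      Graph (x , y) = Σ (IA.Open x) λ ox → _≈_ B (proj₁ (to f (x , ox))) y

      -- The coordinates of an operation of `A ⊗ B` are the operations of the factors only up to
      -- `_≈_`; this absorbs the difference.
      graph : ∀ {p} (a : ∃ IA.Open) → _≈_ A (proj₁ p) (proj₁ a) →
              _≈_ B (proj₁ (to f a)) (proj₂ p) → Graph p
      graph a e q = trans A (IA.g-cong e) (trans A (proj₂ a) (sym A e)) , trans B (cong f e) q

      p₁ : Hom (A ⊗ B) A
      p₁ = π₁ {A = A} {B = B}

      p₂ : Hom (A ⊗ B) B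
      p₂ = π₂ {A = A} {B = B}

      graph-closed : P.HeytingClosed Graph
      graph-closed = record
        { ∨-closed = λ {p} {q} (op′ , fp) (oq′ , fq) →
            let as = (proj₁ p , op′) ∷ (proj₁ q , oq′) ∷ [] in
            graph (A°.⟦ ∨′ ⟧ as) (hom-∨ p₁ p q)
              (trans B (homo f ∨′ as) (trans B (PB.∨-cong fp fq) (sym B (hom-∨ p₂ p q))))
        ; ∧-closed = λ {p} {q} (op′ , fp) (oq′ , fq) →
            let as = (proj₁ p , op′) ∷ (proj₁ q , oq′) ∷ [] in
            graph (A°.⟦ ∧′ ⟧ as) (hom-∧ p₁ p q)
              (trans B (homo f ∧′ as) (trans B (PB.∧-cong fp fq) (sym B (hom-∧ p₂ p q))))
        ; ⇒-closed = λ {p} {q} (op′ , fp) (oq′ , fq) →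
            let as = (proj₁ p , op′) ∷ (proj₁ q , oq′) ∷ [] in
            graph (A°.⟦ ⇒′ ⟧ as)
              (trans A (hom-g p₁ (IP.- p IP.∨ q)) (IA.g-cong
                (trans A (hom-∨ p₁ (IP.- p) q) (PA.∨-cong (hom-- p₁ p) (refl A)))))
              (trans B (homo f ⇒′ as) (sym B (trans B (hom-g p₂ (IP.- p IP.∨ q)) (IB.g-cong
                (trans B (hom-∨ p₂ (IP.- p) q)
                  (PB.∨-cong (trans B (hom-- p₂ p) (PB.¬-cong (sym B fp))) (sym B fq)))))))
        ; ⊤-closed = graph (A°.⟦ ⊤′ ⟧ []) (hom-⊤ p₁)
            (trans B (homo f ⊤′ []) (sym B (hom-⊤ p₂)))
        ; ⊥-closed = graph (A°.⟦ ⊥′ ⟧ []) (hom-⊥ p₁)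
            (trans B (homo f ⊥′ []) (sym B (hom-⊥ p₂)))
        }

      monotone : ∀ {p q} → Graph p → Graph q → proj₁ p IA.≤ proj₁ q → proj₂ p IB.≤ proj₂ q
      monotone {p} {q} (op′ , fp) (oq′ , fq) p≤q =
        trans B (sym B fp) (trans B (cong f {y = A°.⟦ ∧′ ⟧ as} p≤q)
          (trans B (homo f ∧′ as) (PB.∧-cong fp fq)))
        where
        as = (proj₁ p , op′) ∷ (proj₁ q , oq′) ∷ []

      -- A meet is `⊤` exactly when each clause is, and `- a ∨ b ≈ ⊤` says `a ≤ b`, which passes
      -- along the graph because `f` preserves meets.
      preserves-⊤ : ∀ {p} → P.NormalForm Graph p → _≈_ A (proj₁ p) IA.⊤ → _≈_ B (proj₂ p) IB.⊤
      preserves-⊤ (P.top (_ , e)) _ = trans B e (hom-⊤ p₂)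
      preserves-⊤ (P.meet {a} {b} {q} γa γb n (e₁ , e₂)) p≈⊤ =
        let clause≈⊤ , q≈⊤ = PA.∧≈⊤ (trans A (sym A (expand iA p₁)) (trans A (sym A e₁) p≈⊤))
        in trans B e₂ (trans B (expand iB p₂) (trans B
             (PB.∧-cong (PB.≤⇒⊤ (monotone γa γb (PA.⊤⇒≤ clause≈⊤))) (preserves-⊤ n q≈⊤))
             (PB.∧-identityˡ _)))
        where
        expand : ∀ {C} (iC : IsInteriorAlgebra C) (h : Hom (A ⊗ B) C) → let open InteriorOperations C in
                 _≈_ C (to h ((IP.- a IP.∨ b) IP.∧ q)) ((- to h a ∨ to h b) ∧ to h q)
        expand {C} iC h = trans C (hom-∧ h _ _) (∧-cong
          (trans C (hom-∨ h _ _) (∨-cong (hom-- h _) (refl C))) (refl C))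
          where open InteriorProperties iC

      -- The inequality is `- p ∨ q ≈ ⊤` read in a coordinate, and `- p ∨ q` has a normal form over
      -- `Graph`.
      generated-monotone : ∀ {p q} → Generated (A ⊗ B) Graph p → Generated (A ⊗ B) Graph q →
                           proj₁ p IA.≤ proj₁ q → proj₂ p IB.≤ proj₂ q
      generated-monotone {p} {q} γp γq p≤q = PB.⊤⇒≤ (trans B (sym B
          (trans B (hom-∨ p₂ (IP.- p) q) (PB.∨-cong (hom-- p₂ p) (refl B))))
        (preserves-⊤
          (P.nf-∨ graph-closed (P.nf-- graph-closed (P.generated⇒nf graph-closed γp))
                               (P.generated⇒nf graph-closed γq))
          (trans A (hom-∨ p₁ (IP.- p) q)
            (trans A (PA.∨-cong (hom-- p₁ p) (refl A)) (PA.≤⇒⊤ p≤q)))))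

      functional : ∀ {p q} → Generated (A ⊗ B) Graph p → Generated (A ⊗ B) Graph q →
                   _≈_ A (proj₁ p) (proj₁ q) → _≈_ B (proj₂ p) (proj₂ q)
      functional γp γq p≈q = PB.antisym
        (generated-monotone γp γq (PA.≤-reflexive p≈q))
        (generated-monotone γq γp (PA.≤-reflexive (sym A p≈q)))

      total : ∀ {x} → Generated A IA.Open x → ∃[ y ] Generated (A ⊗ B) Graph (x , y)
      total (gen ox)   = _ , gen (ox , refl B)
      total (op o ps)  = _ , op o λ i → proj₂ (total (ps i))
      total (resp e p) = map₂ (resp (e , refl B)) (total p)

    extension : Hom A B
    extension .to x        = proj₁ (total (A* x))
    -- Congruence and the homomorphism law both compare second coordinates of generated pairs whose
    -- first coordinates are equal.
    extension .cong        = functional (proj₂ (total (A* _))) (proj₂ (total (A* _)))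
    extension .homo o as   = functional (proj₂ (total (A* _)))
      (op o λ i → proj₂ (total (A* (as i)))) (refl A)

    extension-open : ∀ a → _≈_ B (to extension (proj₁ a)) (proj₁ (to f a))
    extension-open (x , ox) = functional (proj₂ (total (A* x))) (gen (ox , refl B)) (refl A)

-- The categories of finitely presented algebras of V and of γ V

private
  data NoRelations {X : Set} : Rel (Term interiorSignature X) 0ℓ where

  data OpenGenerators {X : Set} : Rel (Term interiorSignature X) 0ℓ where
    generator-open : ∀ x → OpenGenerators (app g′ (var x ∷ [])) (var x)

module _ {V : Pred (Algebra interiorSignature) ℓ} (isVariety : IsVariety V)
         (V⊆Int : V ⊆ IsInteriorAlgebra) (locallyFinite : LocallyFinite V) (V⊆V* : V ⊆ V *) where

  open Algebra
  open Hom

  private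
    variable
      A B : Algebra interiorSignature
      H K : Algebra heytingSignature

    E : Pred Equation 0ℓ
    E = proj₁ isVariety

    V⊆Mod : V ⊆ Mod E
    V⊆Mod = proj₁ (proj₂ isVariety)

    Mod⊆V : Mod E ⊆ V
    Mod⊆V = proj₂ (proj₂ isVariety)

    Ω : V A → Algebra heytingSignature
    Ω {A = A} A∈V = openElements A (V⊆Int A∈V)

    Ω∈γ : (A∈V : V A) → γ V (Ω A∈V)
    Ω∈γ A∈V = _ , A∈V , V⊆Int A∈V , ≅-refl

    Ωʰ : (A∈V : V A) (B∈V : V B) → Hom A B → Hom (Ω A∈V) (Ω B∈V)
    Ωʰ A∈V B∈V = restrict (V⊆Int A∈V) (V⊆Int B∈V)

    V-⊗ : V A → V B → V (A ⊗ B)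
    V-⊗ {A = A} {B = B} A∈V B∈V = Mod⊆V (Mod-⊗ {A = A} {B = B} (V⊆Mod A∈V) (V⊆Mod B∈V))

  module _ (A∈V : V A) (B∈V : V B) (A* : Is*-Algebra A) (f : Hom (Ω A∈V) (Ω B∈V)) where

    open Extension (V⊆Int A∈V) (V⊆Int B∈V) (V⊆Int (V-⊗ A∈V B∈V)) A* f public
      renaming (extension to extend; extension-open to extend-open)

  *-Representation : Algebra heytingSignature → Set (lsuc 0ℓ ⊔ ℓ)
  *-Representation K = ∃[ C ] Σ (V C) λ C∈V → Is*-Algebra C × K ≅ Ω C∈V

  -- The subalgebra of `B` generated by its open elements stays in the variety and has the same open
  -- elements as `B`.
  γ-*-representation : γ V K → *-Representation K
  γ-*-representation {K = K} (B , B∈V , iB , e) = C , C∈V , C* ,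
    ≅-trans {A = K} e (≅-sym (ι , (λ p → p) , surjective ι λ (x , ox) →
      ((x , gen ox) , C-open ox) , refl B))
    where
    Open : Pred (Carrier B) 0ℓ
    Open = InteriorOperations.Open B
    C : Algebra interiorSignature
    C = subalgebra B Open
    C∈V : V C
    C∈V = Mod⊆V (Mod-subalgebra (V⊆Mod B∈V))
    C-open : ∀ {x} → Open (proj₁ x) → InteriorOperations.Open C x
    C-open ox = trans B (⟦⟧-cong B g′ λ { 0F → refl B }) ox
    C* : Is*-Algebra C
    C* x = Generated-mono {A = C} {Q = InteriorOperations.Open C} (λ {x} → C-open {x})
      (subalgebra-generated {A = B} x)
    ι : Hom (Ω C∈V) (openElements B iB)
    ι = restrict (V⊆Int C∈V) iB (inclusion {A = B} Open)

  Ω-listable : (A∈V : V A) → Listable (setoid A) → Listable (setoid (Ω A∈V))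
  Ω-listable {A = A} A∈V (n , a , a-onto) =
    n , (λ i → g (a i) , IsInteriorAlgebra.g-idem (V⊆Int A∈V) (a i)) ,
    λ (y , oy) → map₂ (λ ai≈y → trans A (g-cong ai≈y) oy) (a-onto y)
    where open InteriorOperations A

  V-free : HasListableFreeAlgebras V
  V-free n = presented , var , record
    { inClass = F∈V
    ; extend  = λ B B∈V b → lift {B = B} (V⊆Mod B∈V) b (λ ()) , λ _ → refl B
    ; unique  = λ B _ h k agree → hom-unique presented-generated h k λ (i , t∼xᵢ) →
        trans B (cong h t∼xᵢ) (trans B (agree i) (cong k (∼-sym t∼xᵢ)))
    } , finite-listable (locallyFinite presented F∈V (n , var , presented-generated))
    where
    open Presentation E (Fin n) NoRelations
    F∈V : V presented
    F∈V = Mod⊆V presented∈Mod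

  -- The free algebra of γ V consists of the open elements of the algebra
  -- of V freely generated by open elements.

  γ-free : HasListableFreeAlgebras (γ V)
  γ-free n = Ω G∈V , x , record
    { inClass = Ω∈γ G∈V
    ; extend  = λ K K∈γ → extend-free K (γ-*-representation K∈γ)
    ; unique  = λ K K∈γ → unique-free K (γ-*-representation K∈γ)
    } , Ω-listable G∈V (finite-listable (locallyFinite presented G∈V (n , var , presented-generated)))
    where
    open Presentation E (Fin n) OpenGenerators
    G∈V : V presented
    G∈V = Mod⊆V presented∈Mod
    open InteriorOperations presented using (Open; g-cong)
    var-open : ∀ i → Open (var i)
    var-open i = relation (generator-open i)
    G* : Is*-Algebra presented
    G* t = Generated-mono {Q = Open}
      (λ (i , t∼xᵢ) → ∼-trans (g-cong t∼xᵢ) (∼-trans (var-open i) (∼-sym t∼xᵢ)))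
      (presented-generated t)
    x : Fin n → Carrier (Ω G∈V)
    x i = var i , var-open i

    extend-free : ∀ K → *-Representation K → (b : Fin n → Carrier K) →
                  Σ (Hom (Ω G∈V) K) λ h → ∀ i → _≈_ K (to h (x i)) (b i)
    extend-free K (C , C∈V , _ , e) b = inverse e ∘ʰ Ωʰ G∈V C∈V ℎ , λ i → trans K
      (cong (inverse e) {to (Ωʰ G∈V C∈V ℎ) (x i)} {to (proj₁ e) (b i)} (refl C))
      (inverse∘to e (b i))
      where
      ℎ : Hom presented C
      ℎ = lift (V⊆Mod C∈V) (λ i → proj₁ (to (proj₁ e) (b i))) λ where
        (generator-open i) → trans C (⟦⟧-cong C g′ λ { 0F → refl C }) (proj₂ (to (proj₁ e) (b i)))

    -- Both maps are extended to `presented` and compared there, where the variables generate; the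
    -- term operations include complement and `g`, which are not operations of `Ω G∈V`.
    unique-free : ∀ K → *-Representation K →
                  (h k : Hom (Ω G∈V) K) → (∀ i → _≈_ K (to h (x i)) (to k (x i))) →
                  ∀ y → _≈_ K (to h y) (to k y)
    unique-free K (C , C∈V , _ , e , e-injective , _) h k agree y = e-injective
      (trans C (sym C (extend-open G∈V C∈V G* (e ∘ʰ h) y))
        (trans C (hom-unique presented-generated ĥ k̂ (λ (i , t∼xᵢ) →
            trans C (cong ĥ t∼xᵢ) (trans C (agree′ i) (cong k̂ (∼-sym t∼xᵢ)))) (proj₁ y))
          (extend-open G∈V C∈V G* (e ∘ʰ k) y)))
      where
      ĥ k̂ : Hom presented C
      ĥ = extend G∈V C∈V G* (e ∘ʰ h)
      k̂ = extend G∈V C∈V G* (e ∘ʰ k)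
      agree′ : ∀ i → _≈_ C (to ĥ (var i)) (to k̂ (var i))
      agree′ i = trans C (extend-open G∈V C∈V G* (e ∘ʰ h) (x i))
        (trans C (cong e (agree i)) (sym C (extend-open G∈V C∈V G* (e ∘ʰ k) (x i))))

  -- Local finiteness turns the list into a bijection with some `Fin n`, which also makes equality
  -- decidable.
  fp⇒finite : V A → IsFinitelyPresented V A → Finite (setoid A)
  fp⇒finite A∈V fp = locallyFinite _ A∈V
    (listable⇒finitelyGenerated (finitelyPresented⇒listable V-free fp))

  -- Here the *-variety hypothesis enters: the variety defined by the axiom contains the *-algebras
  -- of `V`, hence `V *`, hence `V`.
  V-grzegorczyk : (A∈V : V A) → InteriorProperties.Grzegorczyk (V⊆Int A∈V)
  V-grzegorczyk A∈V = ⊨⇒grzegorczyk (V⊆Int A∈V)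
    (V⊆V* A∈V (Mod (_≡ grzegorczykEquation)) (_ , (λ p → p) , λ p → p)
      (λ { (B∈V , B*) _ ≡.refl → grzegorczyk⇒⊨ (V⊆Int B∈V)
             (InteriorProperties.*-algebra⇒grzegorczyk (V⊆Int B∈V) B*) })
      _ ≡.refl)

  fp⇒* : V A → IsFinitelyPresented V A → Is*-Algebra A
  fp⇒* A∈V fp = InteriorProperties.grzegorczyk⇒*-algebra (V⊆Int A∈V) (V-grzegorczyk A∈V)
    (finite-listable (fp⇒finite A∈V fp)) (finite-≟ (fp⇒finite A∈V fp))

  Ω-fp : (A∈V : V A) → IsFinitelyPresented V A → IsFinitelyPresented (γ V) (Ω A∈V)
  Ω-fp A∈V fp = listable⇒finitelyPresented γ-free (Ω∈γ A∈V)
    (Ω-listable A∈V (finite-listable (fp⇒finite A∈V fp)))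
    λ a b → finite-≟ (fp⇒finite A∈V fp) (proj₁ a) (proj₁ b)

  -- A list of `K` yields all open elements of `A`. They generate the *-algebra `A`, so it is finite
  -- by local finiteness.
  Ω-fp⁻ : (A∈V : V A) → Is*-Algebra A → K ≅ Ω A∈V →
          IsFinitelyPresented (γ V) K → IsFinitelyPresented V A
  Ω-fp⁻ {A = A} {K = K} A∈V A* e fp =
    listable⇒finitelyPresented V-free A∈V (finite-listable A-finite) (finite-≟ A-finite)
    where
    finite : Listable (setoid K) → Finite (setoid A)
    finite (n , k , k-onto) = locallyFinite A A∈V
      (n , (λ i → proj₁ (to (proj₁ e) (k i))) , λ x → Generated-mono
        (λ {x} ox → let i , kᵢ≈ = k-onto (to (inverse e) (x , ox)) in
          i , sym A (trans A (cong (proj₁ e) kᵢ≈) (to∘inverse e (x , ox))))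
        (A* x))
    A-finite : Finite (setoid A)
    A-finite = finite (finitelyPresented⇒listable γ-free fp)

  -- The lifting problem is moved to *-algebras `C` and `D` representing `K` and `L`, solved there
  -- by projectivity of `A`, and the solution restricted to open elements. The extended map is onto
  -- because its image contains the open generators of `D`.
  Ω-projective : (A∈V : V A) → Is*-Algebra A → IsProjective V A → IsProjective (γ V) (Ω A∈V)
  Ω-projective {A = A} A∈V A* projective K L K∈γ L∈γ f f-surjective p
    with C , C∈V , C* , e ← γ-*-representation K∈γ
       | D , D∈V , D* , d ← γ-*-representation L∈γ =
    inverse e ∘ʰ Ωʰ A∈V C∈V h , λ x → proj₁ (proj₂ d)
      (trans D (sym D (extend-open C∈V D∈V C* f′ (Ωʰ A∈V C∈V h .to x)))
        (trans D (f̂h≈p̂ (proj₁ x)) (extend-open A∈V D∈V A* (proj₁ d ∘ʰ p) x)))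
    where
    f′ : Hom (Ω C∈V) (Ω D∈V)
    f′ = proj₁ d ∘ʰ f ∘ʰ inverse e
    f̂ : Hom C D
    f̂ = extend C∈V D∈V C* f′
    f̂-surjective : IsSurjective f̂
    f̂-surjective = generated-surjective D* f̂ λ {y} oy →
      let z , fz≈y = surjective⁻ f f-surjective (to (inverse d) (y , oy))
          c = to (proj₁ e) z
      in proj₁ c , trans D (extend-open C∈V D∈V C* f′ c)
           (trans D (cong (proj₁ d) (trans L (cong f (inverse∘to e z)) fz≈y)) (to∘inverse d (y , oy)))
    lifted = projective C D C∈V D∈V f̂ f̂-surjective (extend A∈V D∈V A* (proj₁ d ∘ʰ p))
    h : Hom A C
    h = proj₁ lifted
    f̂h≈p̂ = proj₂ lifted

  -- The problem is restricted to open elements, where the lifting `h` exists. Its extension solves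
  -- the original problem since both maps agree on the open generators of `A`.
  Ω-projective⁻ : (A∈V : V A) → Is*-Algebra A → K ≅ Ω A∈V → IsProjective (γ V) K → IsProjective V A
  Ω-projective⁻ {A = A} {K = K} A∈V A* e projective B C B∈V C∈V f f-surjective p =
    ĥ , hom-unique A* (f ∘ʰ ĥ) p λ {x} ox →
      trans C (cong f (extend-open A∈V B∈V A* (h ∘ʰ inverse e) (x , ox)))
        (trans C (fh≈pe (to (inverse e) (x , ox))) (cong p (to∘inverse e (x , ox))))
    where
    lifted = projective (Ω B∈V) (Ω C∈V) (Ω∈γ B∈V) (Ω∈γ C∈V) (Ωʰ B∈V C∈V f)
      (restrict-surjective (V⊆Int B∈V) (V⊆Int C∈V) f f-surjective) (Ωʰ A∈V C∈V p ∘ʰ proj₁ e)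
    h : Hom K (Ω B∈V)
    h = proj₁ lifted
    fh≈pe = proj₂ lifted
    ĥ : Hom A B
    ĥ = extend A∈V B∈V A* (h ∘ʰ inverse e)

  -- The quasiorders of unifiers of `A` and of its open elements

  module _ (A∈V : V A) (A* : Is*-Algebra A) (e : H ≅ Ω A∈V) where

    Φ : Unifier V A → Unifier (γ V) H
    Φ u = record
      { target              = Ω inClass
      ; inClass             = Ω∈γ inClass
      ; isFinitelyPresented = Ω-fp inClass isFinitelyPresented
      ; isProjective        = Ω-projective inClass (fp⇒* inClass isFinitelyPresented) isProjective
      ; hom                 = Ωʰ A∈V inClass hom ∘ʰ proj₁ e
      }
      where open Unifier u

    module Ψ (v : Unifier (γ V) H) where
      open Unifier v
      private
        representation : *-Representation target
        representation = γ-*-representation inClass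

      C : Algebra interiorSignature
      C = proj₁ representation

      C∈V : V C
      C∈V = proj₁ (proj₂ representation)

      C* : Is*-Algebra C
      C* = proj₁ (proj₂ (proj₂ representation))

      d : target ≅ Ω C∈V
      d = proj₂ (proj₂ (proj₂ representation))

      hom° : Hom (Ω A∈V) (Ω C∈V)
      hom° = proj₁ d ∘ʰ hom ∘ʰ inverse e

      unifier : Unifier V A
      unifier = record
        { target              = C
        ; inClass             = C∈V
        ; isFinitelyPresented = Ω-fp⁻ C∈V C* d isFinitelyPresented
        ; isProjective        = Ω-projective⁻ C∈V C* d isProjective
        ; hom                 = extend A∈V C∈V A* hom°
        }

      -- The round trip changes a unifier only by the isomorphism `d`; `d` and its inverse then give
      -- the two comparisons with `v`.
      hom-Φ : ∀ x → _≈_ (Ω C∈V) (to (Unifier.hom (Φ unifier)) x) (to (proj₁ d ∘ʰ hom) x)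
      hom-Φ x = trans C {i = proj₁ (to (Unifier.hom (Φ unifier)) x)}
                          {j = proj₁ (to hom° (to (proj₁ e) x))}
                          {k = proj₁ (to (proj₁ d ∘ʰ hom) x)}
        (extend-open A∈V C∈V A* hom° (to (proj₁ e) x))
        (cong (proj₁ d ∘ʰ hom) (inverse∘to e x))

    Ω-μ-Set : ∀ I → μ-Set V A I ⇔ μ-Set (γ V) H I
    Ω-μ-Set = μ-Set-⇔ Φ Ψ.unifier Φ-mono Φ-reflect ΦΨ≽ ≽ΦΨ
      where
      Φ-mono : ∀ u v → MoreGeneral V u v → MoreGeneral (γ V) (Φ u) (Φ v)
      Φ-mono u v (h , p) = Ωʰ (Unifier.inClass u) (Unifier.inClass v) h , λ x → p (proj₁ (to (proj₁ e) x))

      Φ-reflect : ∀ u v → MoreGeneral (γ V) (Φ u) (Φ v) → MoreGeneral V u v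
      -- Targets of unifiers in `V` are *-algebras, so `k` extends. The two maps out of `A` are
      -- compared on an open `a`, which is first replaced by `a′` since `p` speaks of elements of
      -- `H`.
      Φ-reflect u v (k , p) = k̂ , hom-unique A* v.hom (k̂ ∘ʰ u.hom) λ {x} ox →
        let a  = x , ox
            a′ = to (proj₁ e) (to (inverse e) a)
            u° = Ωʰ A∈V u.inClass u.hom
        in trans v.target (cong v.hom (sym A (to∘inverse e a)))
             (trans v.target (p (to (inverse e) a))
               (trans v.target (cong (k ∘ʰ u°) {a′} {a} (to∘inverse e a))
                 (sym v.target (extend-open u.inClass v.inClass U* k (to u° a)))))
        where
        module u = Unifier u
        module v = Unifier v
        U* : Is*-Algebra u.target
        U* = fp⇒* u.inClass u.isFinitelyPresented
        k̂ : Hom u.target v.target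
        k̂ = extend u.inClass v.inClass U* k

      ΦΨ≽ : ∀ v → MoreGeneral (γ V) (Φ (Ψ.unifier v)) v
      ΦΨ≽ v = inverse d , λ x → sym target
        (trans target (cong (inverse d) (hom-Φ x)) (inverse∘to d (to hom x)))
        where
        open Unifier v
        open Ψ v

      ≽ΦΨ : ∀ v → MoreGeneral (γ V) v (Φ (Ψ.unifier v))
      ≽ΦΨ v = proj₁ d , hom-Φ
        where open Ψ v

  -- Matching the unifiable algebras of `V` and `γ V`

  V⇒γ : MatchesUnifiableAlgebras V (γ V)
  V⇒γ A = record
    { algebra             = Ω inClass
    ; inClass             = Ω∈γ inClass
    ; isFinitelyPresented = Ω-fp inClass isFinitelyPresented
    ; unifier             = Φ inClass A* ≅-refl unifier
    } , Ω-μ-Set inClass A* ≅-refl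
    where
    open UnifiableAlgebra A
    A* : Is*-Algebra algebra
    A* = fp⇒* inClass isFinitelyPresented

  γ⇒V : MatchesUnifiableAlgebras (γ V) V
  γ⇒V H with C , C∈V , C* , e ← γ-*-representation (UnifiableAlgebra.inClass H) = record
    { algebra             = C
    ; inClass             = C∈V
    ; isFinitelyPresented = Ω-fp⁻ C∈V C* e isFinitelyPresented
    ; unifier             = Ψ.unifier C∈V C* e unifier
    } , λ I → ⇔-sym (Ω-μ-Set C∈V C* e I)
    where open UnifiableAlgebra H

theorem5p13 : {ℓ : Level} (V : Pred (Algebra interiorSignature) ℓ) →
    IsVariety V → V ⊆ IsInteriorAlgebra →
    LocallyFinite V → Is*-Variety V →
    (τ : UnificationType) → HasUnificationType V τ ⇔ HasUnificationType (γ V) τ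
theorem5p13 V isVariety V⊆Int locallyFinite is*-variety τ =
  mk⇔ (unificationType-map forth back τ) (unificationType-map back forth τ)
  where
  forth : MatchesUnifiableAlgebras V (γ V)
  forth = V⇒γ isVariety V⊆Int locallyFinite (proj₁ is*-variety)
  back : MatchesUnifiableAlgebras (γ V) V
  back = γ⇒V isVariety V⊆Int locallyFinite (proj₁ is*-variety)
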